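{- Let $G_{m,n}=P_m\,\Box\,P_n$ be the grid graph. If $m,n\ge 3$, then \begin{align*} SWW_3(G_{m,n})=\frac{1}{360}\big(&9m^5n^3+15m^4n^4+9m^3n^5+15m^4n^3+15m^3n^4-30m^4n^2-50m^3n^3-30m^2n^4\\ &+26m^3n-45m^3n^2-45m^2n^3+45m^2n^2+26mn^3+30m^2n+30mn^2-20mn\big). \end{align*} Moreover, for every $n\ge 3$, $$SWW_3(G_{2,n})=\frac{1}{15}\left(3n^5+10n^4-25n^2+12n\right).$$
   Context: $P_k$ is the path on $k$ vertices and $\Box$ is the Cartesian product of graphs. For nonempty $S\subseteq V(G)$, the Steiner distance $d(S)$ is the minimum number of edges of a connected subgraph of $G$ whose vertex set contains $S$, and $SWW_3(G)=\frac12\sum_{S\subseteq V(G),|S|=3}d(S)+\frac12\sum_{S\subseteq V(G),|S|=3}d(S)^2$. -}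

module Defs where

open import Level using (0ℓ)
open import Data.Nat using (ℕ; zero; suc; _≤_)
open import Data.Fin using (Fin; toℕ)
open import Data.Product using (_×_; _,_; Σ; ∃)
open import Data.Sum using (_⊎_)
open import Data.List using (List; []; _∷_; map; _++_; length; cartesianProduct; allFin)
open import Data.Nat.ListAction using (sum)
open import Data.List.Membership.Propositional using (_∈_)
open import Data.List.Relation.Unary.All using (All)
open import Data.List.Relation.Unary.AllPairs using (AllPairs)
open import Relation.Nullary using (¬_)
open import Relation.Binary.PropositionalEquality using (_≡_)

record Graph : Set₁ where
  field
    V   : Set
    Adj : V → V → Set
open Graph public

P : ℕ → Graph
P k = record
  { V   = Fin k
  ; Adj = λ i j → (suc (toℕ i) ≡ toℕ j) ⊎ (suc (toℕ j) ≡ toℕ i) }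

_□_ : Graph → Graph → Graph
G □ H = record
  { V   = V G × V H
  ; Adj = λ { (a , b) (a' , b') → (a ≡ a' × Adj H b b') ⊎ (Adj G a a' × b ≡ b') } }

gridVertices : (m n : ℕ) → List (V (P m □ P n))
gridVertices m n = cartesianProduct (allFin m) (allFin n)

module _ (G : Graph) where

  Edge : Set
  Edge = V G × V G

  SameEdge : Edge → Edge → Set
  SameEdge (u , v) (u' , v') = (u ≡ u' × v ≡ v') ⊎ (u ≡ v' × v ≡ u')

  data Reach (Es : List Edge) : V G → V G → Set where
    here : ∀ {u} → Reach Es u u
    step : ∀ {u v w} → ((u , v) ∈ Es ⊎ (v , u) ∈ Es) → Reach Es v w → Reach Es u w

  record Subgraph : Set where
    constructor subgraph
    field
      Vs       : List (V G)
      Es       : List Edge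
      edgesAdj : All (λ e → Adj G (Data.Product.proj₁ e) (Data.Product.proj₂ e)) Es
      edgesIn  : All (λ e → Data.Product.proj₁ e ∈ Vs × Data.Product.proj₂ e ∈ Vs) Es
      distinct : AllPairs (λ e f → ¬ SameEdge e f) Es

  open Subgraph public

  size : Subgraph → ℕ
  size H = length (Es H)

  Connected : Subgraph → Set
  Connected H = ∀ {u v} → u ∈ Vs H → v ∈ Vs H → Reach (Es H) u v

  ConnectedContaining : List (V G) → Subgraph → Set
  ConnectedContaining S H = Connected H × All (λ x → x ∈ Vs H) S

  IsSteinerDistance : List (V G) → ℕ → Set
  IsSteinerDistance S k =
    (Σ Subgraph λ H → ConnectedContaining S H × size H ≡ k) ×
    (∀ H → ConnectedContaining S H → k ≤ size H)

-- all 3-element sublists (i<j<k positions) of a list; for a duplicate-free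
-- enumeration of V(G) this lists every 3-subset exactly once.
pairsWith : {A : Set} → A → List A → List (A × A × A)
pairsWith x [] = []
pairsWith x (y ∷ ys) = map (λ z → x , y , z) ys ++ pairsWith x ys

triples : {A : Set} → List A → List (A × A × A)
triples [] = []
triples (x ∷ xs) = pairsWith x xs ++ triples xs

-- Given a Steiner-distance function d on triples, Σ_{|S|=3} (d(S) + d(S)^2)  = 2·SWW_3
sww3Twice : {A : Set} → List A → (A → A → A → ℕ) → ℕ
sww3Twice vs d = sum (map (λ { (x , y , z) → d x y z Data.Nat.+ d x y z Data.Nat.* d x y z }) (triples vs))

module Submission where

-- In P_m □ P_n the Steiner distance of {x, y, z} is the sum over the two coordinates of the
-- spread (max − min) of the three coordinate values: the L-shaped walks from x, y and z to their
-- coordinatewise median use that many edges, and a connected subgraph containing x, y and z must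
-- cross each unit cut between the extreme coordinates with its own edge.  As d is symmetric and
-- vanishes on the diagonal, the sum of d + d² over ordered triples is 6 times the sum over
-- 3-subsets plus 3 times the sum over the triples (u, u, v).  On the grid both summands are sums
-- of products of a function of the first coordinates and a function of the second, so these sums
-- factor into sums over a single path, whose closed forms follow by induction on its length.

open import Defs

module GridSteinerDistance where

  open import Data.Empty using (⊥; ⊥-elim)
  open import Data.Fin using (Fin; toℕ; splitAt; join) renaming (zero to fzero; suc to fsuc)
  open import Data.Fin.Properties using (toℕ<n; toℕ-injective; join-splitAt; injective⇒≤)
    renaming (_≟_ to _≟ᶠ_)
  open import Data.List using (List; []; _∷_; _++_; map; length; deduplicate)
  open import Data.List.Properties using (length-++; length-deduplicate)
  open import Data.List.Membership.Propositional using (_∈_; find; lose)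
  open import Data.List.Membership.Propositional.Properties using (∈-++⁺ˡ; ∈-++⁺ʳ; ∈-++⁻)
  open import Data.List.Membership.Setoid.Properties using (index-injective)
  open import Data.List.Relation.Unary.All as All using (All; []; _∷_)
  open import Data.List.Relation.Unary.All.Properties using (all-filter)
  import Data.List.Relation.Unary.All.Properties as All
  open import Data.List.Relation.Unary.AllPairs using (AllPairs; []; _∷_)
  import Data.List.Relation.Unary.AllPairs.Properties as AllPairs
  open import Data.List.Relation.Unary.Any as Any using (Any; here; there)
  open import Data.List.Relation.Unary.Any.Properties using (Any-⊎⁻)
  import Data.List.Relation.Unary.Any.Properties as Any
  open import Data.Nat using (ℕ; zero; suc; _+_; _∸_; _⊔_; _⊓_; _≤_; _<_; _≤?_; ∣_-_∣; s≤s; s≤s⁻¹)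
  open import Data.Nat.Properties
  open import Data.Nat.ListAction using (sum)
  open import Data.Nat.Tactic.RingSolver using (solve-∀)
  open import Data.Product using (Σ; ∃; _×_; _,_; proj₁; proj₂)
  import Data.Product as Product
  open import Data.Product.Properties using (≡-dec)
  open import Data.Sum using (_⊎_; inj₁; inj₂; [_,_]′)
  import Data.Sum as Sum
  open import Function using (_∘_; Injective)
  open import Relation.Binary.Construct.Closure.ReflexiveTransitive using (Star; ε; _◅_; _◅◅_; gmap)
  open import Relation.Binary.Definitions using (Decidable; DecidableEquality)
  open import Relation.Binary.PropositionalEquality
  open import Relation.Nullary using (¬_; yes; no; ¬?)
  open import Relation.Nullary.Decidable using (_×-dec_; _⊎-dec_)
  open import Algebra.Definitions using (Selective)


  spread : ℕ → ℕ → ℕ → ℕ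
  spread a b c = a ⊔ b ⊔ c ∸ a ⊓ b ⊓ c

  spread-swap₁₂ : ∀ a b c → spread a b c ≡ spread b a c
  spread-swap₁₂ a b c = cong₂ _∸_ (cong (_⊔ c) (⊔-comm a b)) (cong (_⊓ c) (⊓-comm a b))

  spread-swap₂₃ : ∀ a b c → spread a b c ≡ spread a c b
  spread-swap₂₃ a b c = cong₂ _∸_
    (trans (⊔-assoc a b c) (trans (cong (a ⊔_) (⊔-comm b c)) (sym (⊔-assoc a c b))))
    (trans (⊓-assoc a b c) (trans (cong (a ⊓_) (⊓-comm b c)) (sym (⊓-assoc a c b))))

  spread-diag : ∀ a → spread a a a ≡ 0
  spread-diag a = trans (cong₂ _∸_ (trans (cong (_⊔ a) (⊔-idem a)) (⊔-idem a))
                                  (trans (cong (_⊓ a) (⊓-idem a)) (⊓-idem a)))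
                        (n∸n≡0 a)

  spread-dup : ∀ a b → spread a b b ≡ spread a a b
  spread-dup a b = cong₂ _∸_
    (trans (⊔-assoc a b b) (trans (cong (a ⊔_) (⊔-idem b)) (cong (_⊔ b) (sym (⊔-idem a)))))
    (trans (⊓-assoc a b b) (trans (cong (a ⊓_) (⊓-idem b)) (cong (_⊓ b) (sym (⊓-idem a)))))

  spread-pair-sym : ∀ a b → spread a a b ≡ spread b b a
  spread-pair-sym a b = trans (spread-swap₂₃ a a b) (trans (spread-swap₁₂ a b a) (spread-dup b a))

  record IsMedian (a b c d : ℕ) : Set where
    constructor isMedian
    field
      distances≡spread : ∣ a - d ∣ + ∣ b - d ∣ + ∣ c - d ∣ ≡ spread a b c

  IsMedian-swap₁₂ : ∀ {a b c d} → IsMedian a b c d → IsMedian b a c d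
  IsMedian-swap₁₂ {a} {b} {c} {d} (isMedian eq) =
    isMedian (trans (cong (_+ ∣ c - d ∣) (+-comm ∣ b - d ∣ ∣ a - d ∣)) (trans eq (spread-swap₁₂ a b c)))

  IsMedian-swap₂₃ : ∀ {a b c d} → IsMedian a b c d → IsMedian a c b d
  IsMedian-swap₂₃ {a} {b} {c} {d} (isMedian eq) =
    isMedian (trans (swap ∣ a - d ∣ ∣ c - d ∣ ∣ b - d ∣) (trans eq (spread-swap₂₃ a b c)))
    where
    swap : ∀ x y z → x + y + z ≡ x + z + y
    swap = solve-∀

  sorted-median : ∀ {a b c} → a ≤ b → b ≤ c → IsMedian a b c b
  sorted-median {a} {b} {c} a≤b b≤c = isMedian (begin
    ∣ a - b ∣ + ∣ b - b ∣ + ∣ c - b ∣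
      ≡⟨ cong₂ _+_ (cong₂ _+_ (m≤n⇒∣m-n∣≡n∸m a≤b) (∣n-n∣≡0 b)) (m≤n⇒∣n-m∣≡n∸m b≤c) ⟩
    b ∸ a + 0 + (c ∸ b)                ≡⟨ cong (_+ (c ∸ b)) (+-identityʳ (b ∸ a)) ⟩
    b ∸ a + (c ∸ b)                    ≡⟨ +-comm (b ∸ a) (c ∸ b) ⟩
    c ∸ b + (b ∸ a)                    ≡⟨ +-∸-assoc (c ∸ b) a≤b ⟨
    c ∸ b + b ∸ a                      ≡⟨ cong (_∸ a) (m∸n+n≡m b≤c) ⟩
    c ∸ a                              ≡⟨ cong₂ _∸_ max≡c min≡a ⟨
    spread a b c                       ∎)
    where
    open ≡-Reasoning
    max≡c : a ⊔ b ⊔ c ≡ c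
    max≡c = trans (cong (_⊔ c) (m≤n⇒m⊔n≡n a≤b)) (m≤n⇒m⊔n≡n b≤c)
    min≡a : a ⊓ b ⊓ c ≡ a
    min≡a = trans (cong (_⊓ c) (m≤n⇒m⊓n≡m a≤b)) (m≤n⇒m⊓n≡m (≤-trans a≤b b≤c))

  median : {A : Set} (κ : A → ℕ) (x y z : A) → Σ A λ w → IsMedian (κ x) (κ y) (κ z) (κ w)
  median κ x y z with κ x ≤? κ y | κ y ≤? κ z | κ x ≤? κ z
  ... | yes x≤y | yes y≤z | _       = y , sorted-median x≤y y≤z
  ... | yes x≤y | no  y≰z | yes x≤z = z , IsMedian-swap₂₃ (sorted-median x≤z (≰⇒≥ y≰z))
  ... | yes x≤y | no  y≰z | no  x≰z =
        x , IsMedian-swap₂₃ (IsMedian-swap₁₂ (sorted-median (≰⇒≥ x≰z) x≤y))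
  ... | no  x≰y | _       | yes x≤z = x , IsMedian-swap₁₂ (sorted-median (≰⇒≥ x≰y) x≤z)
  ... | no  x≰y | yes y≤z | no  x≰z =
        z , IsMedian-swap₁₂ (IsMedian-swap₂₃ (sorted-median y≤z (≰⇒≥ x≰z)))
  ... | no  x≰y | no  y≰z | no  _   =
        y , IsMedian-swap₁₂ (IsMedian-swap₂₃ (IsMedian-swap₁₂ (sorted-median (≰⇒≥ y≰z) (≰⇒≥ x≰y))))

  min≤max : ∀ a b c → a ⊓ b ⊓ c ≤ a ⊔ b ⊔ c
  min≤max a b c = ≤-trans (m⊓n≤m (a ⊓ b) c) (≤-trans (m⊓n≤m a b) (≤-trans (m≤m⊔n a b) (m≤m⊔n (a ⊔ b) c)))

  level-below-max : ∀ a b c (t : Fin (spread a b c)) → a ⊓ b ⊓ c + toℕ t < a ⊔ b ⊔ c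
  level-below-max a b c t = subst (a ⊓ b ⊓ c + toℕ t <_) (m+[n∸m]≡n (min≤max a b c)) (+-monoʳ-< (a ⊓ b ⊓ c) (toℕ<n t))

  extremum : {A : Set} {_∙_ : ℕ → ℕ → ℕ} → Selective _≡_ _∙_ → (κ : A → ℕ) (x y z : A) →
             ∃ λ w → w ∈ x ∷ y ∷ z ∷ [] × κ w ≡ (κ x ∙ κ y) ∙ κ z
  extremum {_∙_ = _∙_} sel κ x y z with sel (κ x ∙ κ y) (κ z)
  ... | inj₂ eq = z , there (there (here refl)) , sym eq
  ... | inj₁ eq with sel (κ x) (κ y)
  ...   | inj₁ eq′ = x , here refl , sym (trans eq eq′)
  ...   | inj₂ eq′ = y , there (here refl) , sym (trans eq eq′)

  AdjacentEdge : (G : Graph) → Edge G → Set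
  AdjacentEdge G e = Adj G (proj₁ e) (proj₂ e)

  EndpointsIn : (G : Graph) → List (V G) → Edge G → Set
  EndpointsIn G Vs e = proj₁ e ∈ Vs × proj₂ e ∈ Vs

  module Reachability (G : Graph) where

    Reach-mono : ∀ {Es Es′ u v} → (∀ {e} → e ∈ Es → e ∈ Es′) → Reach G Es u v → Reach G Es′ u v
    Reach-mono Es⊆Es′ here = here
    Reach-mono Es⊆Es′ (step e∈ r) = step (Sum.map Es⊆Es′ Es⊆Es′ e∈) (Reach-mono Es⊆Es′ r)

    Reach-trans : ∀ {Es u v w} → Reach G Es u v → Reach G Es v w → Reach G Es u w
    Reach-trans here r′ = r′
    Reach-trans (step e∈ r) r′ = step e∈ (Reach-trans r r′)

    Reach-sym : ∀ {Es u v} → Reach G Es u v → Reach G Es v u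
    Reach-sym here = here
    Reach-sym (step e∈ r) = Reach-trans (Reach-sym r) (step (Sum.swap e∈) here)

  module Walks (G : Graph) where
    open Reachability G

    Walk : V G → V G → Set
    Walk = Star (Adj G)

    edges : ∀ {u v} → Walk u v → List (Edge G)
    edges ε = []
    edges (_◅_ {u} {v} a p) = (u , v) ∷ edges p

    vertices : ∀ {u v} → Walk u v → List (V G)
    vertices {u} ε = u ∷ []
    vertices (_◅_ {u} a p) = u ∷ vertices p

    start∈vertices : ∀ {u v} (p : Walk u v) → u ∈ vertices p
    start∈vertices ε = here refl
    start∈vertices (a ◅ p) = here refl

    walk-reach : ∀ {u w} (p : Walk u w) → Reach G (edges p) u w
    walk-reach ε = here
    walk-reach (a ◅ p) = step (inj₁ (here refl)) (Reach-mono there (walk-reach p))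

    vertices-reach-end : ∀ {u v w} (p : Walk u w) → v ∈ vertices p → Reach G (edges p) v w
    vertices-reach-end ε (here refl) = here
    vertices-reach-end (a ◅ p) (here refl) = walk-reach (a ◅ p)
    vertices-reach-end (a ◅ p) (there v∈) = Reach-mono there (vertices-reach-end p v∈)

    edges-adjacent : ∀ {u v} (p : Walk u v) → All (AdjacentEdge G) (edges p)
    edges-adjacent ε = []
    edges-adjacent (a ◅ p) = a ∷ edges-adjacent p

    edges-endpoints : ∀ {u v} (p : Walk u v) → All (EndpointsIn G (vertices p)) (edges p)
    edges-endpoints ε = []
    edges-endpoints (a ◅ p) =
      (here refl , there (start∈vertices p)) ∷ All.map (Product.map there there) (edges-endpoints p)

    length-edges-◅◅ : ∀ {u v w} (p : Walk u v) (q : Walk v w) →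
                      length (edges (p ◅◅ q)) ≡ length (edges p) + length (edges q)
    length-edges-◅◅ ε q = refl
    length-edges-◅◅ (a ◅ p) q = cong suc (length-edges-◅◅ p q)

  length-edges-gmap : ∀ {G H : Graph} (f : V G → V H) (g : ∀ {u v} → Adj G u v → Adj H (f u) (f v))
                      {u v} (p : Walks.Walk G u v) →
                      length (Walks.edges H (gmap f g p)) ≡ length (Walks.edges G p)
  length-edges-gmap f g ε = refl
  length-edges-gmap f g (a ◅ p) = cong suc (length-edges-gmap f g p)

  module Simplify (G : Graph) (_≟_ : DecidableEquality (V G)) where
    open Reachability G

    sameEdge? : Decidable (SameEdge G)
    sameEdge? (u , v) (u′ , v′) = (u ≟ u′ ×-dec v ≟ v′) ⊎-dec (u ≟ v′ ×-dec v ≟ u′)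

    dedup : List (Edge G) → List (Edge G)
    dedup = deduplicate sameEdge?

    dedup-distinct : ∀ Es → AllPairs (λ e f → ¬ SameEdge G e f) (dedup Es)
    dedup-distinct [] = []
    dedup-distinct (e ∷ Es) =
      all-filter (¬? ∘ sameEdge? e) (dedup Es) ∷ AllPairs.filter⁺ (¬? ∘ sameEdge? e) (dedup-distinct Es)

    private
      SameEdge-resp : ∀ {e f g} → SameEdge G g f → SameEdge G e f → SameEdge G e g
      SameEdge-resp (inj₁ (refl , refl)) s = s
      SameEdge-resp (inj₂ (refl , refl)) (inj₁ (refl , refl)) = inj₂ (refl , refl)
      SameEdge-resp (inj₂ (refl , refl)) (inj₂ (refl , refl)) = inj₁ (refl , refl)

      as-same : ∀ {Es u v} → (u , v) ∈ Es ⊎ (v , u) ∈ Es → Any (SameEdge G (u , v)) Es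
      as-same = [ Any.map (λ { refl → inj₁ (refl , refl) }) , Any.map (λ { refl → inj₂ (refl , refl) }) ]′

      from-same : ∀ {Es u v} → Any (SameEdge G (u , v)) Es → (u , v) ∈ Es ⊎ (v , u) ∈ Es
      from-same = Any-⊎⁻ ∘ Any.map λ { (inj₁ (refl , refl)) → inj₁ refl ; (inj₂ (refl , refl)) → inj₂ refl }

    dedup-reach : ∀ {Es u v} → Reach G Es u v → Reach G (dedup Es) u v
    dedup-reach here = here
    dedup-reach (step e∈ r) =
      step (from-same (Any.deduplicate⁺ sameEdge? SameEdge-resp (as-same e∈))) (dedup-reach r)

    simplify : (Vs : List (V G)) (Es : List (Edge G)) →
               All (AdjacentEdge G) Es → All (EndpointsIn G Vs) Es → Subgraph G
    simplify Vs Es adjacent endpoints =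
      subgraph Vs (dedup Es) (All.deduplicate⁺ sameEdge? adjacent) (All.deduplicate⁺ sameEdge? endpoints)
               (dedup-distinct Es)

  module Hub (G : Graph) (_≟_ : DecidableEquality (V G)) (hub : V G) where
    open Reachability G
    open Walks G
    open Simplify G _≟_

    Spoke : Set
    Spoke = Σ (V G) λ u → Walk u hub

    spokeVertices : List Spoke → List (V G)
    spokeVertices [] = []
    spokeVertices ((_ , p) ∷ ps) = vertices p ++ spokeVertices ps

    spokeEdges : List Spoke → List (Edge G)
    spokeEdges [] = []
    spokeEdges ((_ , p) ∷ ps) = edges p ++ spokeEdges ps

    spokeVertices-reach-hub : ∀ ps {v} → v ∈ spokeVertices ps → Reach G (spokeEdges ps) v hub
    spokeVertices-reach-hub ((_ , p) ∷ ps) v∈ with ∈-++⁻ (vertices p) v∈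
    ... | inj₁ v∈p  = Reach-mono ∈-++⁺ˡ (vertices-reach-end p v∈p)
    ... | inj₂ v∈ps = Reach-mono (∈-++⁺ʳ (edges p)) (spokeVertices-reach-hub ps v∈ps)

    spokeEdges-adjacent : ∀ ps → All (AdjacentEdge G) (spokeEdges ps)
    spokeEdges-adjacent [] = []
    spokeEdges-adjacent ((_ , p) ∷ ps) = All.++⁺ (edges-adjacent p) (spokeEdges-adjacent ps)

    spokeEdges-endpoints : ∀ ps → All (EndpointsIn G (spokeVertices ps)) (spokeEdges ps)
    spokeEdges-endpoints [] = []
    spokeEdges-endpoints ((_ , p) ∷ ps) = All.++⁺
      (All.map (Product.map ∈-++⁺ˡ ∈-++⁺ˡ) (edges-endpoints p))
      (All.map (Product.map (∈-++⁺ʳ (vertices p)) (∈-++⁺ʳ (vertices p))) (spokeEdges-endpoints ps))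

    spokes-start : ∀ ps → All (_∈ spokeVertices ps) (map proj₁ ps)
    spokes-start [] = []
    spokes-start ((_ , p) ∷ ps) = ∈-++⁺ˡ (start∈vertices p) ∷ All.map (∈-++⁺ʳ (vertices p)) (spokes-start ps)

    length-spokeEdges : ∀ ps → length (spokeEdges ps) ≡ sum (map (λ s → length (edges (proj₂ s))) ps)
    length-spokeEdges [] = refl
    length-spokeEdges ((_ , p) ∷ ps) = trans (length-++ (edges p)) (cong (length (edges p) +_) (length-spokeEdges ps))

    hubSubgraph : List Spoke → Subgraph G
    hubSubgraph ps = simplify (spokeVertices ps) (spokeEdges ps) (spokeEdges-adjacent ps) (spokeEdges-endpoints ps)

    hubSubgraph-connectedContaining : ∀ ps → ConnectedContaining G (map proj₁ ps) (hubSubgraph ps)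
    hubSubgraph-connectedContaining ps =
      (λ u∈ v∈ → Reach-trans (dedup-reach (spokeVertices-reach-hub ps u∈))
                             (Reach-sym (dedup-reach (spokeVertices-reach-hub ps v∈))))
      , spokes-start ps

    hubSubgraph-size : ∀ ps → size G (hubSubgraph ps) ≤ length (spokeEdges ps)
    hubSubgraph-size ps = length-deduplicate sameEdge? (spokeEdges ps)

  UnitStep : ℕ → ℕ → Set
  UnitStep a b = b ≤ suc a × a ≤ suc b

  UnitStep-refl : ∀ {a b} → a ≡ b → UnitStep a b
  UnitStep-refl refl = n≤1+n _ , n≤1+n _

  UnitStep-suc : ∀ {a b} → suc a ≡ b → UnitStep a b
  UnitStep-suc refl = ≤-refl , ≤-trans (n≤1+n _) (n≤1+n _)

  record Steps {A : Set} (κ : A → ℕ) (j : ℕ) (e : A × A) : Set where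
    constructor steps
    field
      min≡level : κ (proj₁ e) ⊓ κ (proj₂ e) ≡ j
      max≡suc-level : κ (proj₁ e) ⊔ κ (proj₂ e) ≡ suc j

  Steps-flip : ∀ {A : Set} {κ : A → ℕ} {j u v} → Steps κ j (u , v) → Steps κ j (v , u)
  Steps-flip {κ = κ} {u = u} {v} (steps min≡j max≡1+j) =
    steps (trans (⊓-comm (κ v) (κ u)) min≡j) (trans (⊔-comm (κ v) (κ u)) max≡1+j)

  ¬Steps-level : ∀ {A : Set} {κ : A → ℕ} {j u v} → κ u ≡ κ v → ¬ Steps κ j (u , v)
  ¬Steps-level {κ = κ} {j} {u} {v} eq (steps min≡j max≡1+j) = 1+n≢n (begin
    suc j          ≡⟨ max≡1+j ⟨
    κ u ⊔ κ v      ≡⟨ cong (κ u ⊔_) eq ⟨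
    κ u ⊔ κ u      ≡⟨ ⊔-idem (κ u) ⟩
    κ u            ≡⟨ ⊓-idem (κ u) ⟨
    κ u ⊓ κ u      ≡⟨ cong (κ u ⊓_) eq ⟩
    κ u ⊓ κ v      ≡⟨ min≡j ⟩
    j              ∎)
    where open ≡-Reasoning

  Steps-level-unique : ∀ {A : Set} {κ : A → ℕ} {j j′ e} → Steps κ j e → Steps κ j′ e → j ≡ j′
  Steps-level-unique (steps min≡j _) (steps min≡j′ _) = trans (sym min≡j) min≡j′

  module Crossing (G : Graph) (κ : V G → ℕ) (κ-step : ∀ {u v} → Adj G u v → UnitStep (κ u) (κ v)) where

    private
      steps-up : ∀ {j u v} → κ u ≤ j → j < κ v → κ v ≤ suc (κ u) → Steps κ j (u , v)
      steps-up {j} {u} {v} u≤j j<v v≤1+u =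
        steps (trans (m≤n⇒m⊓n≡m u≤v) u≡j) (trans (m≤n⇒m⊔n≡n u≤v) v≡1+j)
        where
        u≤v : κ u ≤ κ v
        u≤v = ≤-trans u≤j (<⇒≤ j<v)
        u≡j : κ u ≡ j
        u≡j = ≤-antisym u≤j (s≤s⁻¹ (≤-trans j<v v≤1+u))
        v≡1+j : κ v ≡ suc j
        v≡1+j = ≤-antisym (≤-trans v≤1+u (s≤s u≤j)) j<v

    crossing-edge : ∀ {Es p q j} → All (AdjacentEdge G) Es → Reach G Es p q → κ p ≤ j → j < κ q →
                    Any (λ e → AdjacentEdge G e × Steps κ j e) Es
    crossing-edge adjacent here p≤j j<p = ⊥-elim (<-irrefl refl (≤-<-trans p≤j j<p))
    crossing-edge {j = j} adjacent (step {v = v} e∈ r) u≤j j<q with κ v ≤? j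
    ... | yes v≤j = crossing-edge adjacent r v≤j j<q
    ... | no  v≰j = [ forward , backward ]′ e∈
      where
      forward : _ ∈ _ → Any (λ e → AdjacentEdge G e × Steps κ j e) _
      forward uv∈ = let a = All.lookup adjacent uv∈ in
        lose uv∈ (a , steps-up u≤j (≰⇒> v≰j) (proj₁ (κ-step a)))
      backward : _ ∈ _ → Any (λ e → AdjacentEdge G e × Steps κ j e) _
      backward vu∈ = let a = All.lookup adjacent vu∈ in
        lose vu∈ (a , Steps-flip (steps-up u≤j (≰⇒> v≰j) (proj₂ (κ-step a))))

  witnesses⇒≤-length : {C E : Set} (R : C → E → Set) → (∀ {c c′ e} → R c e → R c′ e → c ≡ c′) →
                       ∀ {k} (cut : Fin k → C) → Injective _≡_ _≡_ cut →
                       (Es : List E) → (∀ i → Any (R (cut i)) Es) → k ≤ length Es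
  witnesses⇒≤-length {E = E} R R-functional cut cut-injective Es witness = injective⇒≤ position-injective
    where
    position : _ → Fin (length Es)
    position i = Any.index (proj₁ (proj₂ (find (witness i))))

    position-injective : Injective _≡_ _≡_ position
    position-injective {i} {j} eq with find (witness i) | find (witness j)
    ... | e , e∈ , Re | e′ , e′∈ , Re′ with index-injective (setoid E) e∈ e′∈ eq
    ... | refl = cut-injective (R-functional Re Re′)

  module PathWalk where
    open Walks

    suc-adjacent : ∀ {m} {i j : Fin m} → Adj (P m) i j → Adj (P (suc m)) (fsuc i) (fsuc j)
    suc-adjacent = Sum.map (cong suc) (cong suc)

    pathWalk : ∀ {m} (i j : Fin m) → Walk (P m) i j
    pathWalk fzero fzero = ε
    pathWalk {suc (suc _)} fzero (fsuc j) = inj₁ refl ◅ gmap fsuc suc-adjacent (pathWalk fzero j)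
    pathWalk {suc (suc _)} (fsuc i) fzero = gmap fsuc suc-adjacent (pathWalk i fzero) ◅◅ (inj₂ refl ◅ ε)
    pathWalk {suc (suc _)} (fsuc i) (fsuc j) = gmap fsuc suc-adjacent (pathWalk i j)

    length-pathWalk : ∀ {m} (i j : Fin m) → length (edges (P m) (pathWalk i j)) ≡ ∣ toℕ i - toℕ j ∣
    length-pathWalk fzero fzero = refl
    length-pathWalk {suc (suc _)} fzero (fsuc j) =
      cong suc (trans (length-edges-gmap fsuc suc-adjacent (pathWalk fzero j)) (length-pathWalk fzero j))
    length-pathWalk {suc (suc _)} (fsuc i) fzero = begin
      length (edges (P _) (gmap fsuc suc-adjacent (pathWalk i fzero) ◅◅ (inj₂ refl ◅ ε)))
        ≡⟨ length-edges-◅◅ (P _) (gmap fsuc suc-adjacent (pathWalk i fzero)) (inj₂ refl ◅ ε) ⟩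
      length (edges (P _) (gmap fsuc suc-adjacent (pathWalk i fzero))) + 1
        ≡⟨ cong (_+ 1) (length-edges-gmap fsuc suc-adjacent (pathWalk i fzero)) ⟩
      length (edges (P _) (pathWalk i fzero)) + 1
        ≡⟨ cong (_+ 1) (trans (length-pathWalk i fzero) (∣-∣-identityʳ (toℕ i))) ⟩
      toℕ i + 1
        ≡⟨ +-comm (toℕ i) 1 ⟩
      suc (toℕ i) ∎
      where open ≡-Reasoning
    length-pathWalk {suc (suc _)} (fsuc i) (fsuc j) =
      trans (length-edges-gmap fsuc suc-adjacent (pathWalk i j)) (length-pathWalk i j)

    path-unitStep : ∀ {m} {i j : Fin m} → Adj (P m) i j → UnitStep (toℕ i) (toℕ j)
    path-unitStep (inj₁ 1+i≡j) = UnitStep-suc 1+i≡j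
    path-unitStep (inj₂ 1+j≡i) = Product.swap (UnitStep-suc 1+j≡i)

  splitAt-injective : ∀ k {l} → Injective _≡_ _≡_ (splitAt k {l})
  splitAt-injective k {l} {i} {j} eq =
    trans (sym (join-splitAt k l i)) (trans (cong (join k l) eq) (join-splitAt k l j))

  module GridDistance (m n : ℕ) where
    open Walks
    open PathWalk

    G : Graph
    G = P m □ P n

    coord₁ coord₂ : V G → ℕ
    coord₁ = toℕ ∘ proj₁
    coord₂ = toℕ ∘ proj₂

    gridSpread : V G → V G → V G → ℕ
    gridSpread x y z = spread (coord₁ x) (coord₁ y) (coord₁ z) + spread (coord₂ x) (coord₂ y) (coord₂ z)

    coord₁-unitStep : ∀ {u v} → Adj G u v → UnitStep (coord₁ u) (coord₁ v)
    coord₁-unitStep (inj₁ (a≡a′ , _)) = UnitStep-refl (cong toℕ a≡a′)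
    coord₁-unitStep (inj₂ (a~a′ , _)) = path-unitStep a~a′

    coord₂-unitStep : ∀ {u v} → Adj G u v → UnitStep (coord₂ u) (coord₂ v)
    coord₂-unitStep (inj₁ (_ , b~b′)) = path-unitStep b~b′
    coord₂-unitStep (inj₂ (_ , b≡b′)) = UnitStep-refl (cong toℕ b≡b′)

    steps-one-axis : ∀ {e j j′} → AdjacentEdge G e → Steps coord₁ j e → Steps coord₂ j′ e → ⊥
    steps-one-axis (inj₁ (a≡a′ , _)) s₁ _ = ¬Steps-level (cong toℕ a≡a′) s₁
    steps-one-axis (inj₂ (_ , b≡b′)) _ s₂ = ¬Steps-level (cong toℕ b≡b′) s₂

    horizontal : ∀ {a a′} (b : Fin n) → Walk (P m) a a′ → Walk G (a , b) (a′ , b)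
    horizontal b = gmap (_, b) (λ a~a′ → inj₂ (a~a′ , refl))

    vertical : ∀ {b b′} (a : Fin m) → Walk (P n) b b′ → Walk G (a , b) (a , b′)
    vertical a = gmap (a ,_) (λ b~b′ → inj₁ (refl , b~b′))

    leg : (p c : V G) → Walk G p c
    leg (a , b) (a′ , b′) = horizontal b (pathWalk a a′) ◅◅ vertical a′ (pathWalk b b′)

    length-leg : ∀ p c → length (edges G (leg p c)) ≡ ∣ coord₁ p - coord₁ c ∣ + ∣ coord₂ p - coord₂ c ∣
    length-leg (a , b) (a′ , b′) =
      trans (length-edges-◅◅ G (horizontal b (pathWalk a a′)) (vertical a′ (pathWalk b b′))) (cong₂ _+_
        (trans (length-edges-gmap (_, b) _ (pathWalk a a′)) (length-pathWalk a a′))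
        (trans (length-edges-gmap (a′ ,_) _ (pathWalk b b′)) (length-pathWalk b b′)))

    _≟ᵍ_ : DecidableEquality (V G)
    _≟ᵍ_ = ≡-dec _≟ᶠ_ _≟ᶠ_

    module UpperBound (x y z : V G) where
      median₁ : Σ (Fin m) λ w → IsMedian (coord₁ x) (coord₁ y) (coord₁ z) (toℕ w)
      median₁ = median toℕ (proj₁ x) (proj₁ y) (proj₁ z)

      median₂ : Σ (Fin n) λ w → IsMedian (coord₂ x) (coord₂ y) (coord₂ z) (toℕ w)
      median₂ = median toℕ (proj₂ x) (proj₂ y) (proj₂ z)

      centre : V G
      centre = proj₁ median₁ , proj₁ median₂

      open Hub G _≟ᵍ_ centre

      legs : List Spoke
      legs = (x , leg x centre) ∷ (y , leg y centre) ∷ (z , leg z centre) ∷ []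

      steinerTree : Subgraph G
      steinerTree = hubSubgraph legs

      steinerTree-connectedContaining : ConnectedContaining G (x ∷ y ∷ z ∷ []) steinerTree
      steinerTree-connectedContaining = hubSubgraph-connectedContaining legs

      legs-length : length (spokeEdges legs) ≡ gridSpread x y z
      legs-length = begin
        length (spokeEdges legs)
          ≡⟨ length-spokeEdges legs ⟩
        length (edges G (leg x centre)) + (length (edges G (leg y centre)) + (length (edges G (leg z centre)) + 0))
          ≡⟨ cong₂ _+_ (length-leg x centre) (cong₂ _+_ (length-leg y centre) (cong (_+ 0) (length-leg z centre))) ⟩
        d₁ x + d₂ x + (d₁ y + d₂ y + (d₁ z + d₂ z + 0))
          ≡⟨ regroup (d₁ x) (d₂ x) (d₁ y) (d₂ y) (d₁ z) (d₂ z) ⟩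
        (d₁ x + d₁ y + d₁ z) + (d₂ x + d₂ y + d₂ z)
          ≡⟨ cong₂ _+_ (IsMedian.distances≡spread (proj₂ median₁)) (IsMedian.distances≡spread (proj₂ median₂)) ⟩
        gridSpread x y z ∎
        where
        open ≡-Reasoning
        d₁ d₂ : V G → ℕ
        d₁ p = ∣ coord₁ p - coord₁ centre ∣
        d₂ p = ∣ coord₂ p - coord₂ centre ∣
        regroup : ∀ a₁ a₂ b₁ b₂ c₁ c₂ →
                  a₁ + a₂ + (b₁ + b₂ + (c₁ + c₂ + 0)) ≡ (a₁ + b₁ + c₁) + (a₂ + b₂ + c₂)
        regroup = solve-∀

      steinerTree-size : size G steinerTree ≤ gridSpread x y z
      steinerTree-size = ≤-trans (hubSubgraph-size legs) (≤-reflexive legs-length)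

    module LowerBound (x y z : V G) (H : Subgraph G) (H-cc : ConnectedContaining G (x ∷ y ∷ z ∷ []) H) where
      private
        min max : (V G → ℕ) → ℕ
        min κ = κ x ⊓ κ y ⊓ κ z
        max κ = κ x ⊔ κ y ⊔ κ z

      levels-crossed : (κ : V G → ℕ) → (∀ {u v} → Adj G u v → UnitStep (κ u) (κ v)) →
                       ∀ {j} → min κ ≤ j → j < max κ → Any (λ e → AdjacentEdge G e × Steps κ j e) (Es H)
      levels-crossed κ κ-step min≤j j<max with extremum ⊓-sel κ x y z | extremum ⊔-sel κ x y z
      ... | p , p∈ , κp≡min | q , q∈ , κq≡max =
        Crossing.crossing-edge G κ κ-step (edgesAdj H) (proj₁ H-cc (All.lookup (proj₂ H-cc) p∈) (All.lookup (proj₂ H-cc) q∈))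
          (subst (_≤ _) (sym κp≡min) min≤j) (subst (_ <_) (sym κq≡max) j<max)

      r₁ r₂ : ℕ
      r₁ = spread (coord₁ x) (coord₁ y) (coord₁ z)
      r₂ = spread (coord₂ x) (coord₂ y) (coord₂ z)

      Crosses : Fin r₁ ⊎ Fin r₂ → Edge G → Set
      Crosses (inj₁ t) e = AdjacentEdge G e × Steps coord₁ (min coord₁ + toℕ t) e
      Crosses (inj₂ t) e = AdjacentEdge G e × Steps coord₂ (min coord₂ + toℕ t) e

      Crosses-functional : ∀ {c c′ e} → Crosses c e → Crosses c′ e → c ≡ c′
      Crosses-functional {inj₁ t} {inj₁ t′} (_ , s) (_ , s′) =
        cong inj₁ (toℕ-injective (+-cancelˡ-≡ (min coord₁) _ _ (Steps-level-unique s s′)))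
      Crosses-functional {inj₁ _} {inj₂ _} (a , s) (_ , s′) = ⊥-elim (steps-one-axis a s s′)
      Crosses-functional {inj₂ _} {inj₁ _} (a , s) (_ , s′) = ⊥-elim (steps-one-axis a s′ s)
      Crosses-functional {inj₂ t} {inj₂ t′} (_ , s) (_ , s′) =
        cong inj₂ (toℕ-injective (+-cancelˡ-≡ (min coord₂) _ _ (Steps-level-unique s s′)))

      crossed : ∀ c → Any (Crosses c) (Es H)
      crossed (inj₁ t) =
        levels-crossed coord₁ coord₁-unitStep (m≤m+n _ _) (level-below-max (coord₁ x) (coord₁ y) (coord₁ z) t)
      crossed (inj₂ t) =
        levels-crossed coord₂ coord₂-unitStep (m≤m+n _ _) (level-below-max (coord₂ x) (coord₂ y) (coord₂ z) t)

      gridSpread≤size : gridSpread x y z ≤ size G H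
      gridSpread≤size =
        witnesses⇒≤-length Crosses Crosses-functional (splitAt r₁) (splitAt-injective r₁) (Es H) (crossed ∘ splitAt r₁)

    steiner-distance : ∀ {x y z k} → IsSteinerDistance G (x ∷ y ∷ z ∷ []) k → k ≡ gridSpread x y z
    steiner-distance {x} {y} {z} ((H , H-cc , refl) , minimal) =
      ≤-antisym (≤-trans (minimal steinerTree steinerTree-connectedContaining) steinerTree-size)
                (LowerBound.gridSpread≤size x y z H H-cc)
      where open UpperBound x y z


open import Algebra.Properties.CommutativeSemigroup using (interchange)
open import Data.Fin using (Fin; toℕ) renaming (zero to fzero; suc to fsuc)
open import Data.Integer using (ℤ; +_; 0ℤ; _+_; _-_; _*_; _^_)
open import Data.Integer.Properties
  using (+-identityˡ; +-assoc; *-assoc; *-distribˡ-+; *-distribʳ-+; *-zeroʳ; *-cancelˡ-≡; pos-*; +-commutativeSemigroup)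
open import Data.Integer.Tactic.RingSolver using (solve-∀; solve)
open import Data.List using (List; []; _∷_; _++_; map; length; cartesianProduct; allFin)
open import Data.List.Properties using (map-tabulate; length-tabulate)
open import Data.Nat as ℕ using (ℕ; zero; suc; _⊔_; _≥_)
import Data.Nat.Properties as ℕ
open import Data.Nat.ListAction using (sum)
open import Data.Product using (_×_; _,_; proj₁; proj₂)
open import Function using (_∘_; id)
open import Relation.Binary.PropositionalEquality
open ≡-Reasoning

open GridSteinerDistance
  using (module GridDistance; spread; spread-swap₁₂; spread-swap₂₃; spread-diag; spread-dup; spread-pair-sym)

private variable A B : Set

cong₃ : ∀ {A B C D : Set} (f : A → B → C → D) {a a′ b b′ c c′} →
        a ≡ a′ → b ≡ b′ → c ≡ c′ → f a b c ≡ f a′ b′ c′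
cong₃ f refl refl refl = refl

cong₄ : ∀ {A B C D E : Set} (f : A → B → C → D → E) {a a′ b b′ c c′ d d′} →
        a ≡ a′ → b ≡ b′ → c ≡ c′ → d ≡ d′ → f a b c d ≡ f a′ b′ c′ d′
cong₄ f refl refl refl refl = refl

∑ : List A → (A → ℤ) → ℤ
∑ [] f = 0ℤ
∑ (x ∷ xs) f = f x + ∑ xs f

∑² : List A → (A → A → ℤ) → ℤ
∑² xs F = ∑ xs (λ u → ∑ xs (F u))

∑³ : List A → (A → A → A → ℤ) → ℤ
∑³ xs F = ∑ xs (λ u → ∑² xs (F u))

pos-sum : (xs : List A) (f : A → ℕ) → + sum (map f xs) ≡ ∑ xs (λ x → + f x)
pos-sum [] f = refl
pos-sum (x ∷ xs) f = cong (λ s → + f x + s) (pos-sum xs f)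

∑-cong : (xs : List A) {f g : A → ℤ} → (∀ x → f x ≡ g x) → ∑ xs f ≡ ∑ xs g
∑-cong [] f≗g = refl
∑-cong (x ∷ xs) f≗g = cong₂ _+_ (f≗g x) (∑-cong xs f≗g)

∑-+ : (xs : List A) (f g : A → ℤ) → ∑ xs (λ x → f x + g x) ≡ ∑ xs f + ∑ xs g
∑-+ [] f g = refl
∑-+ (x ∷ xs) f g = trans (cong (_+_ (f x + g x)) (∑-+ xs f g)) (interchange +-commutativeSemigroup (f x) (g x) (∑ xs f) (∑ xs g))

∑-*ˡ : (xs : List A) (c : ℤ) (f : A → ℤ) → ∑ xs (λ x → c * f x) ≡ c * ∑ xs f
∑-*ˡ [] c f = sym (*-zeroʳ c)
∑-*ˡ (x ∷ xs) c f = trans (cong (_+_ (c * f x)) (∑-*ˡ xs c f)) (sym (*-distribˡ-+ c (f x) (∑ xs f)))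

∑-const : (xs : List A) (c : ℤ) → ∑ xs (λ _ → c) ≡ + length xs * c
∑-const [] c = refl
∑-const (x ∷ xs) c = trans (cong (_+_ c) (∑-const xs c)) (suc-* (+ length xs) c)
  where
  suc-* : ∀ k c → c + k * c ≡ (+ 1 + k) * c
  suc-* = solve-∀

∑-zero : (xs : List A) → ∑ xs (λ _ → 0ℤ) ≡ 0ℤ
∑-zero [] = refl
∑-zero (x ∷ xs) = cong (_+_ 0ℤ) (∑-zero xs)

∑-++ : (xs ys : List A) (f : A → ℤ) → ∑ (xs ++ ys) f ≡ ∑ xs f + ∑ ys f
∑-++ [] ys f = sym (+-identityˡ (∑ ys f))
∑-++ (x ∷ xs) ys f = trans (cong (_+_ (f x)) (∑-++ xs ys f)) (sym (+-assoc (f x) (∑ xs f) (∑ ys f)))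

∑-map : (g : A → B) (xs : List A) (f : B → ℤ) → ∑ (map g xs) f ≡ ∑ xs (f ∘ g)
∑-map g [] f = refl
∑-map g (x ∷ xs) f = cong (_+_ (f (g x))) (∑-map g xs f)

∑²-map : (g : A → B) (xs : List A) (F : B → B → ℤ) → ∑² (map g xs) F ≡ ∑² xs (λ u v → F (g u) (g v))
∑²-map g xs F = trans (∑-map g xs _) (∑-cong xs (λ u → ∑-map g xs (F (g u))))

∑³-map : (g : A → B) (xs : List A) (F : B → B → B → ℤ) →
         ∑³ (map g xs) F ≡ ∑³ xs (λ u v w → F (g u) (g v) (g w))
∑³-map g xs F = trans (∑-map g xs _) (∑-cong xs (λ u → ∑²-map g xs (F (g u))))

∑²-+ : (xs : List A) (F G : A → A → ℤ) → ∑² xs (λ u v → F u v + G u v) ≡ ∑² xs F + ∑² xs G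
∑²-+ xs F G = trans (∑-cong xs (λ u → ∑-+ xs (F u) (G u))) (∑-+ xs _ _)

∑³-+ : (xs : List A) (F G : A → A → A → ℤ) → ∑³ xs (λ u v w → F u v w + G u v w) ≡ ∑³ xs F + ∑³ xs G
∑³-+ xs F G = trans (∑-cong xs (λ u → ∑²-+ xs (F u) (G u))) (∑-+ xs _ _)

∑-⊗ : (xs : List A) (ys : List B) (α : A → ℤ) (β : B → ℤ) →
      ∑ (cartesianProduct xs ys) (λ p → α (proj₁ p) * β (proj₂ p)) ≡ ∑ xs α * ∑ ys β
∑-⊗ [] ys α β = refl
∑-⊗ (x ∷ xs) ys α β = begin
  ∑ (map (x ,_) ys ++ cartesianProduct xs ys) (λ p → α (proj₁ p) * β (proj₂ p))
    ≡⟨ ∑-++ (map (x ,_) ys) (cartesianProduct xs ys) _ ⟩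
  ∑ (map (x ,_) ys) (λ p → α (proj₁ p) * β (proj₂ p)) + ∑ (cartesianProduct xs ys) (λ p → α (proj₁ p) * β (proj₂ p))
    ≡⟨ cong₂ _+_ (trans (∑-map (x ,_) ys _) (∑-*ˡ ys (α x) β)) (∑-⊗ xs ys α β) ⟩
  α x * ∑ ys β + ∑ xs α * ∑ ys β
    ≡⟨ *-distribʳ-+ (∑ ys β) (α x) (∑ xs α) ⟨
  (α x + ∑ xs α) * ∑ ys β ∎

∑²-⊗ : (xs : List A) (ys : List B) (α : A → A → ℤ) (β : B → B → ℤ) →
       ∑² (cartesianProduct xs ys) (λ u v → α (proj₁ u) (proj₁ v) * β (proj₂ u) (proj₂ v)) ≡ ∑² xs α * ∑² ys β
∑²-⊗ xs ys α β = trans (∑-cong (cartesianProduct xs ys) (λ u → ∑-⊗ xs ys (α (proj₁ u)) (β (proj₂ u))))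
                       (∑-⊗ xs ys (λ a → ∑ xs (α a)) (λ b → ∑ ys (β b)))

∑³-⊗ : (xs : List A) (ys : List B) (α : A → A → A → ℤ) (β : B → B → B → ℤ) →
       ∑³ (cartesianProduct xs ys) (λ u v w → α (proj₁ u) (proj₁ v) (proj₁ w) * β (proj₂ u) (proj₂ v) (proj₂ w)) ≡
       ∑³ xs α * ∑³ ys β
∑³-⊗ xs ys α β = trans (∑-cong (cartesianProduct xs ys) (λ u → ∑²-⊗ xs ys (α (proj₁ u)) (β (proj₂ u))))
                       (∑-⊗ xs ys (λ a → ∑² xs (α a)) (λ b → ∑² ys (β b)))

separable² : List ((A → A → ℤ) × (B → B → ℤ)) → A × B → A × B → ℤ
separable² ts u v = ∑ ts (λ t → proj₁ t (proj₁ u) (proj₁ v) * proj₂ t (proj₂ u) (proj₂ v))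

separable³ : List ((A → A → A → ℤ) × (B → B → B → ℤ)) → A × B → A × B → A × B → ℤ
separable³ ts u v w = ∑ ts (λ t → proj₁ t (proj₁ u) (proj₁ v) (proj₁ w) * proj₂ t (proj₂ u) (proj₂ v) (proj₂ w))

∑²-separable : (xs : List A) (ys : List B) (ts : List ((A → A → ℤ) × (B → B → ℤ))) →
               ∑² (cartesianProduct xs ys) (separable² ts) ≡ ∑ ts (λ t → ∑² xs (proj₁ t) * ∑² ys (proj₂ t))
∑²-separable xs ys [] = trans (∑-cong (cartesianProduct xs ys) (λ _ → ∑-zero (cartesianProduct xs ys)))
                              (∑-zero (cartesianProduct xs ys))
∑²-separable xs ys ((α , β) ∷ ts) = trans (∑²-+ (cartesianProduct xs ys) _ (separable² ts))
                                          (cong₂ _+_ (∑²-⊗ xs ys α β) (∑²-separable xs ys ts))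

∑³-separable : (xs : List A) (ys : List B) (ts : List ((A → A → A → ℤ) × (B → B → B → ℤ))) →
               ∑³ (cartesianProduct xs ys) (separable³ ts) ≡ ∑ ts (λ t → ∑³ xs (proj₁ t) * ∑³ ys (proj₂ t))
∑³-separable xs ys [] = trans (∑-cong (cartesianProduct xs ys) (λ _ →
                          trans (∑-cong (cartesianProduct xs ys) (λ _ → ∑-zero (cartesianProduct xs ys)))
                                (∑-zero (cartesianProduct xs ys))))
                              (∑-zero (cartesianProduct xs ys))
∑³-separable xs ys ((α , β) ∷ ts) = trans (∑³-+ (cartesianProduct xs ys) _ (separable³ ts))
                                          (cong₂ _+_ (∑³-⊗ xs ys α β) (∑³-separable xs ys ts))

∑²-cons-symmetric : (F : A → A → ℤ) → (∀ u v → F u v ≡ F v u) → ∀ x xs →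
                    ∑² (x ∷ xs) F ≡ F x x + + 2 * ∑ xs (F x) + ∑² xs F
∑²-cons-symmetric F F-sym x xs = begin
  F x x + ∑ xs (F x) + ∑ xs (λ u → F u x + ∑ xs (F u))
    ≡⟨ cong (_+_ (F x x + ∑ xs (F x))) (∑-+ xs (λ u → F u x) (λ u → ∑ xs (F u))) ⟩
  F x x + ∑ xs (F x) + (∑ xs (λ u → F u x) + ∑² xs F)
    ≡⟨ cong (λ s → F x x + ∑ xs (F x) + (s + ∑² xs F)) (∑-cong xs (λ u → F-sym u x)) ⟩
  F x x + ∑ xs (F x) + (∑ xs (F x) + ∑² xs F)
    ≡⟨ regroup (F x x) (∑ xs (F x)) (∑² xs F) ⟩
  F x x + + 2 * ∑ xs (F x) + ∑² xs F ∎
  where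
  regroup : ∀ a b c → a + b + (b + c) ≡ a + + 2 * b + c
  regroup = solve-∀

∑³-cons-symmetric : (F : A → A → A → ℤ) → (∀ u v w → F u v w ≡ F v u w) → (∀ u v w → F u v w ≡ F u w v) →
                    ∀ x xs → ∑³ (x ∷ xs) F ≡ F x x x + + 3 * ∑ xs (F x x) + + 3 * ∑² xs (F x) + ∑³ xs F
∑³-cons-symmetric F F-swap₁₂ F-swap₂₃ x xs = begin
  ∑² (x ∷ xs) (F x) + ∑ xs (λ u → ∑² (x ∷ xs) (F u))
    ≡⟨ cong₂ _+_ (∑²-cons-symmetric (F x) (F-swap₂₃ x) x xs)
                 (∑-cong xs (λ u → ∑²-cons-symmetric (F u) (F-swap₂₃ u) x xs)) ⟩
  F x x x + + 2 * ∑ xs (F x x) + ∑² xs (F x) + ∑ xs (λ u → F u x x + + 2 * ∑ xs (F u x) + ∑² xs (F u))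
    ≡⟨ cong (_+_ (F x x x + + 2 * ∑ xs (F x x) + ∑² xs (F x))) split ⟩
  F x x x + + 2 * ∑ xs (F x x) + ∑² xs (F x) + (∑ xs (λ u → F u x x) + + 2 * ∑² xs (λ u → F u x) + ∑³ xs F)
    ≡⟨ cong₂ (λ s t → F x x x + + 2 * ∑ xs (F x x) + ∑² xs (F x) + (s + + 2 * t + ∑³ xs F))
             (∑-cong xs (λ u → trans (F-swap₁₂ u x x) (F-swap₂₃ x u x)))
             (∑-cong xs (λ u → ∑-cong xs (F-swap₁₂ u x))) ⟩
  F x x x + + 2 * ∑ xs (F x x) + ∑² xs (F x) + (∑ xs (F x x) + + 2 * ∑² xs (F x) + ∑³ xs F)
    ≡⟨ regroup (F x x x) (∑ xs (F x x)) (∑² xs (F x)) (∑³ xs F) ⟩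
  F x x x + + 3 * ∑ xs (F x x) + + 3 * ∑² xs (F x) + ∑³ xs F ∎
  where
  split : ∑ xs (λ u → F u x x + + 2 * ∑ xs (F u x) + ∑² xs (F u)) ≡
          ∑ xs (λ u → F u x x) + + 2 * ∑² xs (λ u → F u x) + ∑³ xs F
  split = trans (∑-+ xs _ _) (cong (_+ ∑³ xs F)
                (trans (∑-+ xs _ _) (cong (_+_ (∑ xs (λ u → F u x x))) (∑-*ˡ xs (+ 2) _))))
  regroup : ∀ a b c d → a + + 2 * b + c + (b + + 2 * c + d) ≡ a + + 3 * b + + 3 * c + d
  regroup = solve-∀

pairSum : (A → A → ℤ) → List A → ℤ
pairSum F [] = 0ℤ
pairSum F (y ∷ ys) = ∑ ys (F y) + pairSum F ys

∑²-symmetric : (F : A → A → ℤ) → (∀ u v → F u v ≡ F v u) → ∀ xs →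
               ∑² xs F ≡ + 2 * pairSum F xs + ∑ xs (λ v → F v v)
∑²-symmetric F F-sym [] = refl
∑²-symmetric F F-sym (y ∷ ys) = begin
  ∑² (y ∷ ys) F
    ≡⟨ ∑²-cons-symmetric F F-sym y ys ⟩
  F y y + + 2 * ∑ ys (F y) + ∑² ys F
    ≡⟨ cong (_+_ (F y y + + 2 * ∑ ys (F y))) (∑²-symmetric F F-sym ys) ⟩
  F y y + + 2 * ∑ ys (F y) + (+ 2 * pairSum F ys + ∑ ys (λ v → F v v))
    ≡⟨ regroup (F y y) (∑ ys (F y)) (pairSum F ys) (∑ ys (λ v → F v v)) ⟩
  + 2 * (∑ ys (F y) + pairSum F ys) + (F y y + ∑ ys (λ v → F v v)) ∎
  where
  regroup : ∀ a b c d → a + + 2 * b + (+ 2 * c + d) ≡ + 2 * (b + c) + (a + d)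
  regroup = solve-∀

module TripleSum (f : A → A → A → ℤ)
                 (f-swap₁₂ : ∀ x y z → f x y z ≡ f y x z) (f-swap₂₃ : ∀ x y z → f x y z ≡ f x z y)
                 (f-diag : ∀ x → f x x x ≡ 0ℤ) (f-dup : ∀ x y → f x y y ≡ f x x y) where

  f-triple : A × A × A → ℤ
  f-triple (x , y , z) = f x y z

  f-diagonal : A → A → ℤ
  f-diagonal u v = f u u v

  f-diagonal-sym : ∀ u v → f-diagonal u v ≡ f-diagonal v u
  f-diagonal-sym u v = trans (f-swap₂₃ u u v) (trans (f-swap₁₂ u v u) (f-dup v u))

  ∑-pairsWith : ∀ x xs → ∑ (pairsWith x xs) f-triple ≡ pairSum (f x) xs
  ∑-pairsWith x [] = refl
  ∑-pairsWith x (y ∷ ys) = trans (∑-++ (map (λ z → x , y , z) ys) (pairsWith x ys) f-triple)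
                                 (cong₂ _+_ (∑-map (λ z → x , y , z) ys f-triple) (∑-pairsWith x ys))

  ∑³≡6∑triples+3∑diagonal : ∀ L → ∑³ L f ≡ + 6 * ∑ (triples L) f-triple + + 3 * ∑² L f-diagonal
  ∑³≡6∑triples+3∑diagonal [] = refl
  ∑³≡6∑triples+3∑diagonal (x ∷ xs) = begin
    ∑³ (x ∷ xs) f
      ≡⟨ ∑³-cons-symmetric f f-swap₁₂ f-swap₂₃ x xs ⟩
    f x x x + + 3 * G + + 3 * ∑² xs (f x) + ∑³ xs f
      ≡⟨ cong₂ (λ s t → f x x x + + 3 * G + + 3 * s + t)
               (∑²-symmetric (f x) (f-swap₂₃ x) xs) (∑³≡6∑triples+3∑diagonal xs) ⟩
    f x x x + + 3 * G + + 3 * (+ 2 * pairSum (f x) xs + ∑ xs (λ v → f x v v)) + (+ 6 * T + + 3 * D)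
      ≡⟨ cong₂ (λ a s → a + + 3 * G + + 3 * (+ 2 * pairSum (f x) xs + s) + (+ 6 * T + + 3 * D))
               (f-diag x) (∑-cong xs (f-dup x)) ⟩
    0ℤ + + 3 * G + + 3 * (+ 2 * pairSum (f x) xs + G) + (+ 6 * T + + 3 * D)
      ≡⟨ regroup G (pairSum (f x) xs) T D ⟩
    + 6 * (pairSum (f x) xs + T) + + 3 * (0ℤ + + 2 * G + D)
      ≡⟨ cong₂ (λ s t → + 6 * s + + 3 * t)
               (sym (trans (∑-++ (pairsWith x xs) (triples xs) f-triple) (cong (_+ T) (∑-pairsWith x xs))))
               (sym (trans (∑²-cons-symmetric f-diagonal f-diagonal-sym x xs) (cong (λ a → a + + 2 * G + D) (f-diag x)))) ⟩
    + 6 * ∑ (triples (x ∷ xs)) f-triple + + 3 * ∑² (x ∷ xs) f-diagonal ∎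
    where
    G T D : ℤ
    G = ∑ xs (f x x)
    T = ∑ (triples xs) f-triple
    D = ∑² xs f-diagonal
    regroup : ∀ g p t d → 0ℤ + + 3 * g + + 3 * (+ 2 * p + g) + (+ 6 * t + + 3 * d) ≡
                          + 6 * (p + t) + + 3 * (0ℤ + + 2 * g + d)
    regroup = solve-∀

line : ℕ → (ℕ → ℤ) → ℤ
line m f = ∑ (allFin m) (λ a → f (toℕ a))

square : ℕ → (ℕ → ℕ → ℤ) → ℤ
square m F = ∑² (allFin m) (λ a b → F (toℕ a) (toℕ b))

cube : ℕ → (ℕ → ℕ → ℕ → ℤ) → ℤ
cube m F = ∑³ (allFin m) (λ a b c → F (toℕ a) (toℕ b) (toℕ c))

allFin-suc : ∀ m → allFin (suc m) ≡ fzero ∷ map fsuc (allFin m)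
allFin-suc m = cong (fzero ∷_) (sym (map-tabulate {n = m} id fsuc))

line-cong : ∀ m {f g : ℕ → ℤ} → (∀ k → f k ≡ g k) → line m f ≡ line m g
line-cong m f≗g = ∑-cong (allFin m) (λ a → f≗g (toℕ a))

line-+ : ∀ m (f g : ℕ → ℤ) → line m (λ k → f k + g k) ≡ line m f + line m g
line-+ m f g = ∑-+ (allFin m) (f ∘ toℕ) (g ∘ toℕ)

line-*ˡ : ∀ m c (f : ℕ → ℤ) → line m (λ k → c * f k) ≡ c * line m f
line-*ˡ m c f = ∑-*ˡ (allFin m) c (f ∘ toℕ)

line-const : ∀ m c → line m (λ _ → c) ≡ + m * c
line-const m c = trans (∑-const (allFin m) c) (cong (λ k → + k * c) (length-tabulate {n = m} id))

square-one : ∀ m → square m (λ _ _ → + 1) ≡ + m * (+ m * + 1)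
square-one m = trans (line-cong m (λ _ → line-const m (+ 1))) (line-const m (+ m * + 1))

cube-one : ∀ m → cube m (λ _ _ _ → + 1) ≡ + m * (+ m * (+ m * + 1))
cube-one m = trans (line-cong m (λ _ → square-one m)) (line-const m (+ m * (+ m * + 1)))

line-suc : ∀ m (f : ℕ → ℤ) → line (suc m) f ≡ f 0 + line m (f ∘ suc)
line-suc m f = cong (_+_ (f 0)) (trans (cong (λ xs → ∑ xs (f ∘ toℕ)) (sym (map-tabulate {n = m} id fsuc)))
                                       (∑-map fsuc (allFin m) (f ∘ toℕ)))

square-suc : ∀ m (F : ℕ → ℕ → ℤ) → (∀ a b → F a b ≡ F b a) →
             square (suc m) F ≡ F 0 0 + + 2 * line m (F 0 ∘ suc) + square m (λ a b → F (suc a) (suc b))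
square-suc m F F-sym = begin
  square (suc m) F
    ≡⟨ cong (λ xs → ∑² xs F′) (allFin-suc m) ⟩
  ∑² (fzero ∷ map fsuc (allFin m)) F′
    ≡⟨ ∑²-cons-symmetric F′ (λ a b → F-sym (toℕ a) (toℕ b)) fzero (map fsuc (allFin m)) ⟩
  F 0 0 + + 2 * ∑ (map fsuc (allFin m)) (F′ fzero) + ∑² (map fsuc (allFin m)) F′
    ≡⟨ cong₂ (λ s t → F 0 0 + + 2 * s + t) (∑-map fsuc (allFin m) (F′ fzero)) (∑²-map fsuc (allFin m) F′) ⟩
  F 0 0 + + 2 * line m (F 0 ∘ suc) + square m (λ a b → F (suc a) (suc b)) ∎
  where
  F′ : Fin (suc m) → Fin (suc m) → ℤ
  F′ a b = F (toℕ a) (toℕ b)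

cube-suc : ∀ m (F : ℕ → ℕ → ℕ → ℤ) → (∀ a b c → F a b c ≡ F b a c) → (∀ a b c → F a b c ≡ F a c b) →
           cube (suc m) F ≡ F 0 0 0 + + 3 * line m (F 0 0 ∘ suc) + + 3 * square m (λ b c → F 0 (suc b) (suc c))
                            + cube m (λ a b c → F (suc a) (suc b) (suc c))
cube-suc m F F-swap₁₂ F-swap₂₃ = begin
  cube (suc m) F
    ≡⟨ cong (λ xs → ∑³ xs F′) (allFin-suc m) ⟩
  ∑³ (fzero ∷ map fsuc (allFin m)) F′
    ≡⟨ ∑³-cons-symmetric F′ (λ a b c → F-swap₁₂ (toℕ a) (toℕ b) (toℕ c))
                            (λ a b c → F-swap₂₃ (toℕ a) (toℕ b) (toℕ c))
                         fzero (map fsuc (allFin m)) ⟩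
  F 0 0 0 + + 3 * ∑ (map fsuc (allFin m)) (F′ fzero fzero) + + 3 * ∑² (map fsuc (allFin m)) (F′ fzero)
    + ∑³ (map fsuc (allFin m)) F′
    ≡⟨ cong₃ (λ s t u → F 0 0 0 + + 3 * s + + 3 * t + u)
             (∑-map fsuc (allFin m) _) (∑²-map fsuc (allFin m) _) (∑³-map fsuc (allFin m) F′) ⟩
  F 0 0 0 + + 3 * line m (F 0 0 ∘ suc) + + 3 * square m (λ b c → F 0 (suc b) (suc c))
    + cube m (λ a b c → F (suc a) (suc b) (suc c)) ∎
  where
  F′ : Fin (suc m) → Fin (suc m) → Fin (suc m) → ℤ
  F′ a b c = F (toℕ a) (toℕ b) (toℕ c)

line-shift : ∀ m (f : ℕ → ℤ) → line m (λ k → + 1 + f k) ≡ + m * + 1 + line m f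
line-shift m f = trans (line-+ m (λ _ → + 1) f) (cong (_+ line m f) (line-const m (+ 1)))

line-shift² : ∀ m (f : ℕ → ℤ) →
              line m (λ k → (+ 1 + f k) * (+ 1 + f k)) ≡ line m (λ k → f k * f k) + + 2 * line m f + + m * + 1
line-shift² m f = begin
  line m (λ k → (+ 1 + f k) * (+ 1 + f k))
    ≡⟨ line-cong m (λ k → expand (f k)) ⟩
  line m (λ k → f k * f k + + 2 * f k + + 1)
    ≡⟨ line-+ m (λ k → f k * f k + + 2 * f k) (λ _ → + 1) ⟩
  line m (λ k → f k * f k + + 2 * f k) + line m (λ _ → + 1)
    ≡⟨ cong₂ _+_ (trans (line-+ m (λ k → f k * f k) (λ k → + 2 * f k))
                        (cong (_+_ (line m (λ k → f k * f k))) (line-*ˡ m (+ 2) f)))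
                 (line-const m (+ 1)) ⟩
  line m (λ k → f k * f k) + + 2 * line m f + + m * + 1 ∎
  where
  expand : ∀ y → (+ 1 + y) * (+ 1 + y) ≡ y * y + + 2 * y + + 1
  expand = solve-∀

square-shift : ∀ m (F : ℕ → ℕ → ℤ) → square m (λ a b → + 1 + F a b) ≡ + m * (+ m * + 1) + square m F
square-shift m F = trans (line-cong m (λ a → line-shift m (F a)))
                         (trans (line-+ m (λ _ → + m * + 1) (λ a → line m (F a)))
                                (cong (_+ square m F) (line-const m (+ m * + 1))))

square-shift² : ∀ m (F : ℕ → ℕ → ℤ) →
                square m (λ a b → (+ 1 + F a b) * (+ 1 + F a b)) ≡
                square m (λ a b → F a b * F a b) + + 2 * square m F + + m * (+ m * + 1)
square-shift² m F = begin
  line m (λ a → line m (λ b → (+ 1 + F a b) * (+ 1 + F a b)))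
    ≡⟨ line-cong m (λ a → line-shift² m (F a)) ⟩
  line m (λ a → Q a + + 2 * L a + + m * + 1)
    ≡⟨ line-+ m (λ a → Q a + + 2 * L a) (λ _ → + m * + 1) ⟩
  line m (λ a → Q a + + 2 * L a) + line m (λ _ → + m * + 1)
    ≡⟨ cong₂ _+_ (trans (line-+ m Q (λ a → + 2 * L a)) (cong (_+_ (line m Q)) (line-*ˡ m (+ 2) L)))
                 (line-const m (+ m * + 1)) ⟩
  square m (λ a b → F a b * F a b) + + 2 * square m F + + m * (+ m * + 1) ∎
  where
  Q L : ℕ → ℤ
  Q a = line m (λ b → F a b * F a b)
  L a = line m (F a)

Σsuc Σsuc² Σ²max Σ²max² Σ³spread Σ³spread² Σ²spread Σ²spread² : ℕ → ℤ
Σsuc m = line m (λ k → + suc k)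
Σsuc² m = line m (λ k → + suc k * + suc k)
Σ²max m = square m (λ a b → + (a ⊔ b))
Σ²max² m = square m (λ a b → + (a ⊔ b) * + (a ⊔ b))
Σ³spread m = cube m (λ a b c → + spread a b c)
Σ³spread² m = cube m (λ a b c → + spread a b c * + spread a b c)
Σ²spread m = square m (λ a b → + spread a a b)
Σ²spread² m = square m (λ a b → + spread a a b * + spread a a b)

Σsuc-step : ∀ m → Σsuc (suc m) ≡ + 1 + (+ m * + 1 + Σsuc m)
Σsuc-step m = trans (line-suc m (λ k → + suc k)) (cong (_+_ (+ 1)) (line-shift m (λ k → + suc k)))

Σsuc²-step : ∀ m → Σsuc² (suc m) ≡ + 1 * + 1 + (Σsuc² m + + 2 * Σsuc m + + m * + 1)
Σsuc²-step m = trans (line-suc m (λ k → + suc k * + suc k)) (cong (_+_ (+ 1 * + 1)) (line-shift² m (λ k → + suc k)))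

Σ²max-step : ∀ m → Σ²max (suc m) ≡ + 0 + + 2 * Σsuc m + (+ m * (+ m * + 1) + Σ²max m)
Σ²max-step m = trans (square-suc m _ (λ a b → cong +_ (ℕ.⊔-comm a b)))
                     (cong (_+_ (+ 0 + + 2 * Σsuc m)) (square-shift m (λ a b → + (a ⊔ b))))

Σ²max²-step : ∀ m → Σ²max² (suc m) ≡ + 0 * + 0 + + 2 * Σsuc² m + (Σ²max² m + + 2 * Σ²max m + + m * (+ m * + 1))
Σ²max²-step m = trans (square-suc m _ (λ a b → cong (λ k → + k * + k) (ℕ.⊔-comm a b)))
                      (cong (_+_ (+ 0 * + 0 + + 2 * Σsuc² m)) (square-shift² m (λ a b → + (a ⊔ b))))

Σ³spread-step : ∀ m → Σ³spread (suc m) ≡ + 0 + + 3 * Σsuc m + + 3 * (+ m * (+ m * + 1) + Σ²max m) + Σ³spread m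
Σ³spread-step m = trans (cube-suc m _ (λ a b c → cong +_ (spread-swap₁₂ a b c)) (λ a b c → cong +_ (spread-swap₂₃ a b c)))
                        (cong (λ s → + 0 + + 3 * Σsuc m + + 3 * s + Σ³spread m) (square-shift m (λ a b → + (a ⊔ b))))

Σ³spread²-step : ∀ m → Σ³spread² (suc m) ≡
                 + 0 * + 0 + + 3 * Σsuc² m + + 3 * (Σ²max² m + + 2 * Σ²max m + + m * (+ m * + 1)) + Σ³spread² m
Σ³spread²-step m =
  trans (cube-suc m _ (λ a b c → cong (λ k → + k * + k) (spread-swap₁₂ a b c))
                     (λ a b c → cong (λ k → + k * + k) (spread-swap₂₃ a b c)))
        (cong (λ s → + 0 * + 0 + + 3 * Σsuc² m + + 3 * s + Σ³spread² m) (square-shift² m (λ a b → + (a ⊔ b))))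

Σ²spread-step : ∀ m → Σ²spread (suc m) ≡ + 0 + + 2 * Σsuc m + Σ²spread m
Σ²spread-step m = square-suc m _ (λ a b → cong +_ (spread-pair-sym a b))

Σ²spread²-step : ∀ m → Σ²spread² (suc m) ≡ + 0 * + 0 + + 2 * Σsuc² m + Σ²spread² m
Σ²spread²-step m = square-suc m _ (λ a b → cong (λ k → + k * + k) (spread-pair-sym a b))

Σsuc-closed : ∀ m → + 2 * Σsuc m ≡ + m * + m + + m
Σsuc-closed zero = refl
Σsuc-closed (suc m) = begin
  + 2 * Σsuc (suc m)                   ≡⟨ cong (_*_ (+ 2)) (Σsuc-step m) ⟩
  + 2 * (+ 1 + (x * + 1 + Σsuc m))     ≡⟨ expand x (Σsuc m) ⟩
  + 2 * Σsuc m + (+ 2 + + 2 * x)       ≡⟨ cong (_+ (+ 2 + + 2 * x)) (Σsuc-closed m) ⟩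
  x * x + x + (+ 2 + + 2 * x)          ≡⟨ collect x ⟩
  + suc m * + suc m + + suc m          ∎
  where
  x : ℤ
  x = + m
  expand : ∀ x s → + 2 * (+ 1 + (x * + 1 + s)) ≡ + 2 * s + (+ 2 + + 2 * x)
  expand = solve-∀
  collect : ∀ x → x * x + x + (+ 2 + + 2 * x) ≡ (+ 1 + x) * (+ 1 + x) + (+ 1 + x)
  collect = solve-∀

Σsuc²-closed : ∀ m → + 6 * Σsuc² m ≡ + 2 * (+ m * + m * + m) + + 3 * (+ m * + m) + + m
Σsuc²-closed zero = refl
Σsuc²-closed (suc m) = begin
  + 6 * Σsuc² (suc m)
    ≡⟨ cong (_*_ (+ 6)) (Σsuc²-step m) ⟩
  + 6 * (+ 1 * + 1 + (Σsuc² m + + 2 * Σsuc m + x * + 1))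
    ≡⟨ expand x (Σsuc m) (Σsuc² m) ⟩
  + 6 * Σsuc² m + + 6 * (+ 2 * Σsuc m) + (+ 6 + + 6 * x)
    ≡⟨ cong₂ (λ a b → a + + 6 * b + (+ 6 + + 6 * x)) (Σsuc²-closed m) (Σsuc-closed m) ⟩
  + 2 * (x * x * x) + + 3 * (x * x) + x + + 6 * (x * x + x) + (+ 6 + + 6 * x)
    ≡⟨ collect x ⟩
  + 2 * (+ suc m * + suc m * + suc m) + + 3 * (+ suc m * + suc m) + + suc m ∎
  where
  x : ℤ
  x = + m
  expand : ∀ x s q → + 6 * (+ 1 * + 1 + (q + + 2 * s + x * + 1)) ≡ + 6 * q + + 6 * (+ 2 * s) + (+ 6 + + 6 * x)
  expand = solve-∀
  collect : ∀ x → + 2 * (x * x * x) + + 3 * (x * x) + x + + 6 * (x * x + x) + (+ 6 + + 6 * x) ≡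
                  + 2 * ((+ 1 + x) * (+ 1 + x) * (+ 1 + x)) + + 3 * ((+ 1 + x) * (+ 1 + x)) + (+ 1 + x)
  collect = solve-∀

Σ²max-closed : ∀ m → + 6 * Σ²max m ≡ + 4 * (+ m * + m * + m) - + 3 * (+ m * + m) - + m
Σ²max-closed zero = refl
Σ²max-closed (suc m) = begin
  + 6 * Σ²max (suc m)
    ≡⟨ cong (_*_ (+ 6)) (Σ²max-step m) ⟩
  + 6 * (+ 0 + + 2 * Σsuc m + (x * (x * + 1) + Σ²max m))
    ≡⟨ expand x (Σsuc m) (Σ²max m) ⟩
  + 6 * (+ 2 * Σsuc m) + + 6 * Σ²max m + + 6 * (x * x)
    ≡⟨ cong₂ (λ a b → + 6 * a + b + + 6 * (x * x)) (Σsuc-closed m) (Σ²max-closed m) ⟩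
  + 6 * (x * x + x) + (+ 4 * (x * x * x) - + 3 * (x * x) - x) + + 6 * (x * x)
    ≡⟨ collect x ⟩
  + 4 * (+ suc m * + suc m * + suc m) - + 3 * (+ suc m * + suc m) - + suc m ∎
  where
  x : ℤ
  x = + m
  expand : ∀ x s μ → + 6 * (+ 0 + + 2 * s + (x * (x * + 1) + μ)) ≡ + 6 * (+ 2 * s) + + 6 * μ + + 6 * (x * x)
  expand = solve-∀
  collect : ∀ x → + 6 * (x * x + x) + (+ 4 * (x * x * x) - + 3 * (x * x) - x) + + 6 * (x * x) ≡
                  + 4 * ((+ 1 + x) * (+ 1 + x) * (+ 1 + x)) - + 3 * ((+ 1 + x) * (+ 1 + x)) - (+ 1 + x)
  collect = solve-∀

Σ²max²-closed : ∀ m → + 6 * Σ²max² m ≡ + 3 * (+ m * + m * + m * + m) - + 4 * (+ m * + m * + m) + + m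
Σ²max²-closed zero = refl
Σ²max²-closed (suc m) = begin
  + 6 * Σ²max² (suc m)
    ≡⟨ cong (_*_ (+ 6)) (Σ²max²-step m) ⟩
  + 6 * (+ 0 * + 0 + + 2 * Σsuc² m + (Σ²max² m + + 2 * Σ²max m + x * (x * + 1)))
    ≡⟨ expand x (Σsuc² m) (Σ²max m) (Σ²max² m) ⟩
  + 2 * (+ 6 * Σsuc² m) + + 2 * (+ 6 * Σ²max m) + + 6 * Σ²max² m + + 6 * (x * x)
    ≡⟨ cong₃ (λ a b c → + 2 * a + + 2 * b + c + + 6 * (x * x)) (Σsuc²-closed m) (Σ²max-closed m) (Σ²max²-closed m) ⟩
  + 2 * (+ 2 * (x * x * x) + + 3 * (x * x) + x) + + 2 * (+ 4 * (x * x * x) - + 3 * (x * x) - x)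
    + (+ 3 * (x * x * x * x) - + 4 * (x * x * x) + x) + + 6 * (x * x)
    ≡⟨ collect x ⟩
  + 3 * (+ suc m * + suc m * + suc m * + suc m) - + 4 * (+ suc m * + suc m * + suc m) + + suc m ∎
  where
  x : ℤ
  x = + m
  expand : ∀ x q μ ν → + 6 * (+ 0 * + 0 + + 2 * q + (ν + + 2 * μ + x * (x * + 1))) ≡
                       + 2 * (+ 6 * q) + + 2 * (+ 6 * μ) + + 6 * ν + + 6 * (x * x)
  expand = solve-∀
  collect : ∀ x → + 2 * (+ 2 * (x * x * x) + + 3 * (x * x) + x) + + 2 * (+ 4 * (x * x * x) - + 3 * (x * x) - x)
                    + (+ 3 * (x * x * x * x) - + 4 * (x * x * x) + x) + + 6 * (x * x) ≡
                  + 3 * ((+ 1 + x) * (+ 1 + x) * (+ 1 + x) * (+ 1 + x)) - + 4 * ((+ 1 + x) * (+ 1 + x) * (+ 1 + x)) + (+ 1 + x)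
  collect = solve-∀

Σ³spread-closed : ∀ m → + 2 * Σ³spread m ≡ + m * + m * + m * + m - + m * + m
Σ³spread-closed zero = refl
Σ³spread-closed (suc m) = begin
  + 2 * Σ³spread (suc m)
    ≡⟨ cong (_*_ (+ 2)) (Σ³spread-step m) ⟩
  + 2 * (+ 0 + + 3 * Σsuc m + + 3 * (x * (x * + 1) + Σ²max m) + Σ³spread m)
    ≡⟨ expand x (Σsuc m) (Σ²max m) (Σ³spread m) ⟩
  + 3 * (+ 2 * Σsuc m) + + 6 * Σ²max m + + 2 * Σ³spread m + + 6 * (x * x)
    ≡⟨ cong₃ (λ a b c → + 3 * a + b + c + + 6 * (x * x)) (Σsuc-closed m) (Σ²max-closed m) (Σ³spread-closed m) ⟩
  + 3 * (x * x + x) + (+ 4 * (x * x * x) - + 3 * (x * x) - x) + (x * x * x * x - x * x) + + 6 * (x * x)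
    ≡⟨ collect x ⟩
  + suc m * + suc m * + suc m * + suc m - + suc m * + suc m ∎
  where
  x : ℤ
  x = + m
  expand : ∀ x s μ t → + 2 * (+ 0 + + 3 * s + + 3 * (x * (x * + 1) + μ) + t) ≡
                       + 3 * (+ 2 * s) + + 6 * μ + + 2 * t + + 6 * (x * x)
  expand = solve-∀
  collect : ∀ x → + 3 * (x * x + x) + (+ 4 * (x * x * x) - + 3 * (x * x) - x) + (x * x * x * x - x * x) + + 6 * (x * x) ≡
                  (+ 1 + x) * (+ 1 + x) * (+ 1 + x) * (+ 1 + x) - (+ 1 + x) * (+ 1 + x)
  collect = solve-∀

Σ³spread²-closed : ∀ m → + 10 * Σ³spread² m ≡ + 3 * (+ m * + m * + m * + m * + m) - + 5 * (+ m * + m * + m) + + 2 * + m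
Σ³spread²-closed zero = refl
Σ³spread²-closed (suc m) = begin
  + 10 * Σ³spread² (suc m)
    ≡⟨ cong (_*_ (+ 10)) (Σ³spread²-step m) ⟩
  + 10 * (+ 0 * + 0 + + 3 * Σsuc² m + + 3 * (Σ²max² m + + 2 * Σ²max m + x * (x * + 1)) + Σ³spread² m)
    ≡⟨ expand x (Σsuc² m) (Σ²max m) (Σ²max² m) (Σ³spread² m) ⟩
  + 5 * (+ 6 * Σsuc² m) + + 10 * (+ 6 * Σ²max m) + + 5 * (+ 6 * Σ²max² m) + + 10 * Σ³spread² m + + 30 * (x * x)
    ≡⟨ cong₄ (λ a b c d → + 5 * a + + 10 * b + + 5 * c + d + + 30 * (x * x))
             (Σsuc²-closed m) (Σ²max-closed m) (Σ²max²-closed m) (Σ³spread²-closed m) ⟩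
  + 5 * (+ 2 * (x * x * x) + + 3 * (x * x) + x) + + 10 * (+ 4 * (x * x * x) - + 3 * (x * x) - x)
    + + 5 * (+ 3 * (x * x * x * x) - + 4 * (x * x * x) + x)
    + (+ 3 * (x * x * x * x * x) - + 5 * (x * x * x) + + 2 * x) + + 30 * (x * x)
    ≡⟨ collect x ⟩
  + 3 * (+ suc m * + suc m * + suc m * + suc m * + suc m) - + 5 * (+ suc m * + suc m * + suc m) + + 2 * + suc m ∎
  where
  x : ℤ
  x = + m
  expand : ∀ x q μ ν τ → + 10 * (+ 0 * + 0 + + 3 * q + + 3 * (ν + + 2 * μ + x * (x * + 1)) + τ) ≡
                         + 5 * (+ 6 * q) + + 10 * (+ 6 * μ) + + 5 * (+ 6 * ν) + + 10 * τ + + 30 * (x * x)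
  expand = solve-∀
  collect : ∀ x → + 5 * (+ 2 * (x * x * x) + + 3 * (x * x) + x) + + 10 * (+ 4 * (x * x * x) - + 3 * (x * x) - x)
                    + + 5 * (+ 3 * (x * x * x * x) - + 4 * (x * x * x) + x)
                    + (+ 3 * (x * x * x * x * x) - + 5 * (x * x * x) + + 2 * x) + + 30 * (x * x) ≡
                  + 3 * ((+ 1 + x) * (+ 1 + x) * (+ 1 + x) * (+ 1 + x) * (+ 1 + x))
                    - + 5 * ((+ 1 + x) * (+ 1 + x) * (+ 1 + x)) + + 2 * (+ 1 + x)
  collect = solve-∀

Σ²spread-closed : ∀ m → + 3 * Σ²spread m ≡ + m * + m * + m - + m
Σ²spread-closed zero = refl
Σ²spread-closed (suc m) = begin
  + 3 * Σ²spread (suc m)                      ≡⟨ cong (_*_ (+ 3)) (Σ²spread-step m) ⟩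
  + 3 * (+ 0 + + 2 * Σsuc m + Σ²spread m)     ≡⟨ expand (Σsuc m) (Σ²spread m) ⟩
  + 3 * (+ 2 * Σsuc m) + + 3 * Σ²spread m     ≡⟨ cong₂ (λ a b → + 3 * a + b) (Σsuc-closed m) (Σ²spread-closed m) ⟩
  + 3 * (x * x + x) + (x * x * x - x)         ≡⟨ collect x ⟩
  + suc m * + suc m * + suc m - + suc m       ∎
  where
  x : ℤ
  x = + m
  expand : ∀ s p → + 3 * (+ 0 + + 2 * s + p) ≡ + 3 * (+ 2 * s) + + 3 * p
  expand = solve-∀
  collect : ∀ x → + 3 * (x * x + x) + (x * x * x - x) ≡ (+ 1 + x) * (+ 1 + x) * (+ 1 + x) - (+ 1 + x)
  collect = solve-∀

Σ²spread²-closed : ∀ m → + 6 * Σ²spread² m ≡ + m * + m * + m * + m - + m * + m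
Σ²spread²-closed zero = refl
Σ²spread²-closed (suc m) = begin
  + 6 * Σ²spread² (suc m)                           ≡⟨ cong (_*_ (+ 6)) (Σ²spread²-step m) ⟩
  + 6 * (+ 0 * + 0 + + 2 * Σsuc² m + Σ²spread² m)   ≡⟨ expand (Σsuc² m) (Σ²spread² m) ⟩
  + 2 * (+ 6 * Σsuc² m) + + 6 * Σ²spread² m         ≡⟨ cong₂ (λ a b → + 2 * a + b) (Σsuc²-closed m) (Σ²spread²-closed m) ⟩
  + 2 * (+ 2 * (x * x * x) + + 3 * (x * x) + x) + (x * x * x * x - x * x)
                                                    ≡⟨ collect x ⟩
  + suc m * + suc m * + suc m * + suc m - + suc m * + suc m ∎
  where
  x : ℤ
  x = + m
  expand : ∀ q r → + 6 * (+ 0 * + 0 + + 2 * q + r) ≡ + 2 * (+ 6 * q) + + 6 * r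
  expand = solve-∀
  collect : ∀ x → + 2 * (+ 2 * (x * x * x) + + 3 * (x * x) + x) + (x * x * x * x - x * x) ≡
                  (+ 1 + x) * (+ 1 + x) * (+ 1 + x) * (+ 1 + x) - (+ 1 + x) * (+ 1 + x)
  collect = solve-∀

swwTerm : ℕ → ℤ
swwTerm k = + k + + k * + k

pos-swwTerm : ∀ k → + (k ℕ.+ k ℕ.* k) ≡ swwTerm k
pos-swwTerm k = cong (λ e → + k + e) (pos-* k k)

module GridCount (m n : ℕ) where
  open GridDistance m n using (G; coord₁; coord₂; gridSpread)

  grid : List (V G)
  grid = gridVertices m n

  weight : V G → V G → V G → ℤ
  weight x y z = swwTerm (gridSpread x y z)

  weight-swap₁₂ : ∀ x y z → weight x y z ≡ weight y x z
  weight-swap₁₂ x y z = cong swwTerm (cong₂ ℕ._+_ (spread-swap₁₂ (coord₁ x) (coord₁ y) (coord₁ z))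
                                                 (spread-swap₁₂ (coord₂ x) (coord₂ y) (coord₂ z)))

  weight-swap₂₃ : ∀ x y z → weight x y z ≡ weight x z y
  weight-swap₂₃ x y z = cong swwTerm (cong₂ ℕ._+_ (spread-swap₂₃ (coord₁ x) (coord₁ y) (coord₁ z))
                                                 (spread-swap₂₃ (coord₂ x) (coord₂ y) (coord₂ z)))

  weight-diag : ∀ x → weight x x x ≡ 0ℤ
  weight-diag x = cong swwTerm (cong₂ ℕ._+_ (spread-diag (coord₁ x)) (spread-diag (coord₂ x)))

  weight-dup : ∀ x y → weight x y y ≡ weight x x y
  weight-dup x y = cong swwTerm (cong₂ ℕ._+_ (spread-dup (coord₁ x) (coord₁ y)) (spread-dup (coord₂ x) (coord₂ y)))

  open TripleSum weight weight-swap₁₂ weight-swap₂₃ weight-diag weight-dup public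

  sww3Twice≡∑triples : (d : V G → V G → V G → ℕ) → (∀ x y z → d x y z ≡ gridSpread x y z) →
               + sww3Twice grid d ≡ ∑ (triples grid) f-triple
  sww3Twice≡∑triples d d≡spread = trans (pos-sum (triples grid) _) (∑-cong (triples grid)
    λ { (x , y , z) → trans (pos-swwTerm (d x y z)) (cong swwTerm (d≡spread x y z)) })

  private
    spreadᶠ spreadᶠ² oneᶠ : ∀ {k} → Fin k → Fin k → Fin k → ℤ
    spreadᶠ a b c = + spread (toℕ a) (toℕ b) (toℕ c)
    spreadᶠ² a b c = spreadᶠ a b c * spreadᶠ a b c
    oneᶠ _ _ _ = + 1

    expand : ∀ x y → x + y + (x + y) * (x + y) ≡
             x * + 1 + (x * x * + 1 + (+ 1 * y + (+ 1 * (y * y) + (x * y + (x * y + 0ℤ)))))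
    expand = solve-∀

    regroup³ : ∀ (t u t′ u′ : ℤ) {M N} (m n : ℤ) → M ≡ m * (m * (m * + 1)) → N ≡ n * (n * (n * + 1)) →
               t * N + (u * N + (M * t′ + (M * u′ + (t * t′ + (t * t′ + 0ℤ))))) ≡
               n * n * n * (t + u) + m * m * m * (t′ + u′) + + 2 * (t * t′)
    regroup³ t u t′ u′ m n refl refl = solve (t ∷ u ∷ t′ ∷ u′ ∷ m ∷ n ∷ [])

    regroup² : ∀ (t u t′ u′ : ℤ) {M N} (m n : ℤ) → M ≡ m * (m * + 1) → N ≡ n * (n * + 1) →
               t * N + (u * N + (M * t′ + (M * u′ + (t * t′ + (t * t′ + 0ℤ))))) ≡
               n * n * (t + u) + m * m * (t′ + u′) + + 2 * (t * t′)
    regroup² t u t′ u′ m n refl refl = solve (t ∷ u ∷ t′ ∷ u′ ∷ m ∷ n ∷ [])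

    gapᶠ gapᶠ² oneᶠ′ : ∀ {k} → Fin k → Fin k → ℤ
    gapᶠ a b = + spread (toℕ a) (toℕ a) (toℕ b)
    gapᶠ² a b = gapᶠ a b * gapᶠ a b
    oneᶠ′ _ _ = + 1

  ∑³weight : ∑³ grid weight ≡ + n * + n * + n * (Σ³spread m + Σ³spread² m) + + m * + m * + m * (Σ³spread n + Σ³spread² n)
                    + + 2 * (Σ³spread m * Σ³spread n)
  ∑³weight = trans (∑-cong grid λ u → ∑-cong grid λ v → ∑-cong grid λ w →
                 expand (spreadᶠ (proj₁ u) (proj₁ v) (proj₁ w)) (spreadᶠ (proj₂ u) (proj₂ v) (proj₂ w)))
        (trans (∑³-separable (allFin m) (allFin n)
                  ((spreadᶠ , oneᶠ) ∷ (spreadᶠ² , oneᶠ) ∷ (oneᶠ , spreadᶠ) ∷ (oneᶠ , spreadᶠ²) ∷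
                   (spreadᶠ , spreadᶠ) ∷ (spreadᶠ , spreadᶠ) ∷ []))
               (regroup³ (Σ³spread m) (Σ³spread² m) (Σ³spread n) (Σ³spread² n) (+ m) (+ n) (cube-one m) (cube-one n)))

  ∑²weight-diagonal : ∑² grid f-diagonal ≡ + n * + n * (Σ²spread m + Σ²spread² m) + + m * + m * (Σ²spread n + Σ²spread² n)
                                     + + 2 * (Σ²spread m * Σ²spread n)
  ∑²weight-diagonal = trans (∑-cong grid λ u → ∑-cong grid λ v →
                          expand (gapᶠ (proj₁ u) (proj₁ v)) (gapᶠ (proj₂ u) (proj₂ v)))
                 (trans (∑²-separable (allFin m) (allFin n)
                           ((gapᶠ , oneᶠ′) ∷ (gapᶠ² , oneᶠ′) ∷ (oneᶠ′ , gapᶠ) ∷ (oneᶠ′ , gapᶠ²) ∷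
                            (gapᶠ , gapᶠ) ∷ (gapᶠ , gapᶠ) ∷ []))
                        (regroup² (Σ²spread m) (Σ²spread² m) (Σ²spread n) (Σ²spread² n) (+ m) (+ n) (square-one m) (square-one n)))

-- Powers appear unfolded (m ^ 3 is m * (m * (m * + 1))) since the ring solver does not handle _^_.
moments-polynomial : ∀ (m n : ℤ) {T T′ U U′ P P′ Q Q′} →
  T ≡ m * m * m * m - m * m → T′ ≡ n * n * n * n - n * n →
  U ≡ + 3 * (m * m * m * m * m) - + 5 * (m * m * m) + + 2 * m →
  U′ ≡ + 3 * (n * n * n * n * n) - + 5 * (n * n * n) + + 2 * n →
  P ≡ m * m * m - m → P′ ≡ n * n * n - n →
  Q ≡ m * m * m * m - m * m → Q′ ≡ n * n * n * n - n * n →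
  + 15 * (n * n * n) * T + + 3 * (n * n * n) * U + + 15 * (m * m * m) * T′ + + 3 * (m * m * m) * U′ + + 15 * (T * T′)
  - (+ 30 * (n * n) * P + + 15 * (n * n) * Q + + 30 * (m * m) * P′ + + 15 * (m * m) * Q′ + + 20 * (P * P′)) ≡
    + 9 * (m * (m * (m * (m * (m * + 1))))) * (n * (n * (n * + 1))) + + 15 * (m * (m * (m * (m * + 1)))) * (n * (n * (n * (n * + 1))))
    + + 9 * (m * (m * (m * + 1))) * (n * (n * (n * (n * (n * + 1))))) + + 15 * (m * (m * (m * (m * + 1)))) * (n * (n * (n * + 1)))
    + + 15 * (m * (m * (m * + 1))) * (n * (n * (n * (n * + 1)))) - + 30 * (m * (m * (m * (m * + 1)))) * (n * (n * + 1))
    - + 50 * (m * (m * (m * + 1))) * (n * (n * (n * + 1))) - + 30 * (m * (m * + 1)) * (n * (n * (n * (n * + 1))))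
    + + 26 * (m * (m * (m * + 1))) * n - + 45 * (m * (m * (m * + 1))) * (n * (n * + 1))
    - + 45 * (m * (m * + 1)) * (n * (n * (n * + 1))) + + 45 * (m * (m * + 1)) * (n * (n * + 1))
    + + 26 * m * (n * (n * (n * + 1))) + + 30 * (m * (m * + 1)) * n
    + + 30 * m * (n * (n * + 1)) - + 20 * m * n
moments-polynomial m n refl refl refl refl refl refl refl refl = solve (m ∷ n ∷ [])

sww-polynomial : ∀ (m n s t t′ u u′ p p′ q q′ : ℤ) →
  + 2 * t ≡ m * m * m * m - m * m → + 2 * t′ ≡ n * n * n * n - n * n →
  + 10 * u ≡ + 3 * (m * m * m * m * m) - + 5 * (m * m * m) + + 2 * m →
  + 10 * u′ ≡ + 3 * (n * n * n * n * n) - + 5 * (n * n * n) + + 2 * n →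
  + 3 * p ≡ m * m * m - m → + 3 * p′ ≡ n * n * n - n →
  + 6 * q ≡ m * m * m * m - m * m → + 6 * q′ ≡ n * n * n * n - n * n →
  + 6 * s + + 3 * (n * n * (p + q) + m * m * (p′ + q′) + + 2 * (p * p′)) ≡
    n * n * n * (t + u) + m * m * m * (t′ + u′) + + 2 * (t * t′) →
  + 180 * s ≡
      + 9 * m ^ 5 * n ^ 3 + + 15 * m ^ 4 * n ^ 4 + + 9 * m ^ 3 * n ^ 5 + + 15 * m ^ 4 * n ^ 3
      + + 15 * m ^ 3 * n ^ 4 - + 30 * m ^ 4 * n ^ 2 - + 50 * m ^ 3 * n ^ 3 - + 30 * m ^ 2 * n ^ 4
      + + 26 * m ^ 3 * n - + 45 * m ^ 3 * n ^ 2 - + 45 * m ^ 2 * n ^ 3 + + 45 * m ^ 2 * n ^ 2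
      + + 26 * m * n ^ 3 + + 30 * m ^ 2 * n + + 30 * m * n ^ 2 - + 20 * m * n
sww-polynomial m n s t t′ u u′ p p′ q q′ h-t h-t′ h-u h-u′ h-p h-p′ h-q h-q′ count = begin
  + 180 * s
    ≡⟨ solve (m ∷ n ∷ s ∷ p ∷ p′ ∷ q ∷ q′ ∷ []) ⟩
  + 30 * (+ 6 * s + + 3 * (n * n * (p + q) + m * m * (p′ + q′) + + 2 * (p * p′)))
    - + 90 * (n * n * (p + q) + m * m * (p′ + q′) + + 2 * (p * p′))
    ≡⟨ cong (λ e → + 30 * e - + 90 * (n * n * (p + q) + m * m * (p′ + q′) + + 2 * (p * p′))) count ⟩
  + 30 * (n * n * n * (t + u) + m * m * m * (t′ + u′) + + 2 * (t * t′))
    - + 90 * (n * n * (p + q) + m * m * (p′ + q′) + + 2 * (p * p′))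
    ≡⟨ solve (m ∷ n ∷ t ∷ t′ ∷ u ∷ u′ ∷ p ∷ p′ ∷ q ∷ q′ ∷ []) ⟩
  -- in the multiples 2t, 10u, 3p, 6q, whose closed forms have integer coefficients
  + 15 * (n * n * n) * (+ 2 * t) + + 3 * (n * n * n) * (+ 10 * u) + + 15 * (m * m * m) * (+ 2 * t′)
    + + 3 * (m * m * m) * (+ 10 * u′) + + 15 * ((+ 2 * t) * (+ 2 * t′))
    - (+ 30 * (n * n) * (+ 3 * p) + + 15 * (n * n) * (+ 6 * q) + + 30 * (m * m) * (+ 3 * p′)
       + + 15 * (m * m) * (+ 6 * q′) + + 20 * ((+ 3 * p) * (+ 3 * p′)))
    ≡⟨ moments-polynomial m n h-t h-t′ h-u h-u′ h-p h-p′ h-q h-q′ ⟩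
      + 9 * m ^ 5 * n ^ 3 + + 15 * m ^ 4 * n ^ 4 + + 9 * m ^ 3 * n ^ 5 + + 15 * m ^ 4 * n ^ 3
      + + 15 * m ^ 3 * n ^ 4 - + 30 * m ^ 4 * n ^ 2 - + 50 * m ^ 3 * n ^ 3 - + 30 * m ^ 2 * n ^ 4
      + + 26 * m ^ 3 * n - + 45 * m ^ 3 * n ^ 2 - + 45 * m ^ 2 * n ^ 3 + + 45 * m ^ 2 * n ^ 2
      + + 26 * m * n ^ 3 + + 30 * m ^ 2 * n + + 30 * m * n ^ 2 - + 20 * m * n ∎

-- The formula of sww3Twice-grid at m = 2, with evaluated coefficients and unfolded powers.
ladder-polynomial : ∀ (s x : ℤ) →
  + 180 * s ≡
    + 288 * (x * (x * (x * + 1))) + + 240 * (x * (x * (x * (x * + 1)))) + + 72 * (x * (x * (x * (x * (x * + 1)))))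
    + + 240 * (x * (x * (x * + 1))) + + 120 * (x * (x * (x * (x * + 1)))) - + 480 * (x * (x * + 1))
    - + 400 * (x * (x * (x * + 1))) - + 120 * (x * (x * (x * (x * + 1)))) + + 208 * x
    - + 360 * (x * (x * + 1)) - + 180 * (x * (x * (x * + 1))) + + 180 * (x * (x * + 1))
    + + 52 * (x * (x * (x * + 1))) + + 120 * x + + 60 * (x * (x * + 1))
    - + 40 * x →
  + 15 * s ≡ + 2 * (+ 3 * (x * (x * (x * (x * (x * + 1))))) + + 10 * (x * (x * (x * (x * + 1))))
                    - + 25 * (x * (x * + 1)) + + 12 * x)
ladder-polynomial s x h =
  *-cancelˡ-≡ (+ 12) _ _ (trans (sym (*-assoc (+ 12) (+ 15) s)) (trans h (solve (x ∷ []))))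

sww3Twice-grid : (m n : ℕ) (d : V (P m □ P n) → V (P m □ P n) → V (P m □ P n) → ℕ) →
  (∀ x y z → IsSteinerDistance (P m □ P n) (x ∷ y ∷ z ∷ []) (d x y z)) →
  + 180 * + sww3Twice (gridVertices m n) d ≡
      + 9 * (+ m) ^ 5 * (+ n) ^ 3 + + 15 * (+ m) ^ 4 * (+ n) ^ 4 + + 9 * (+ m) ^ 3 * (+ n) ^ 5 + + 15 * (+ m) ^ 4 * (+ n) ^ 3
      + + 15 * (+ m) ^ 3 * (+ n) ^ 4 - + 30 * (+ m) ^ 4 * (+ n) ^ 2 - + 50 * (+ m) ^ 3 * (+ n) ^ 3 - + 30 * (+ m) ^ 2 * (+ n) ^ 4
      + + 26 * (+ m) ^ 3 * (+ n) - + 45 * (+ m) ^ 3 * (+ n) ^ 2 - + 45 * (+ m) ^ 2 * (+ n) ^ 3 + + 45 * (+ m) ^ 2 * (+ n) ^ 2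
      + + 26 * (+ m) * (+ n) ^ 3 + + 30 * (+ m) ^ 2 * (+ n) + + 30 * (+ m) * (+ n) ^ 2 - + 20 * (+ m) * (+ n)
sww3Twice-grid m n d d-steiner =
  sww-polynomial (+ m) (+ n) (+ sww3Twice grid d) (Σ³spread m) (Σ³spread n) (Σ³spread² m) (Σ³spread² n)
                 (Σ²spread m) (Σ²spread n) (Σ²spread² m) (Σ²spread² n)
                 (Σ³spread-closed m) (Σ³spread-closed n) (Σ³spread²-closed m) (Σ³spread²-closed n)
                 (Σ²spread-closed m) (Σ²spread-closed n) (Σ²spread²-closed m) (Σ²spread²-closed n)
                 (trans (cong₂ (λ a b → + 6 * a + + 3 * b)
                               (sww3Twice≡∑triples d (λ x y z → steiner-distance (d-steiner x y z))) (sym ∑²weight-diagonal))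
                        (trans (sym (∑³≡6∑triples+3∑diagonal grid)) ∑³weight))
  where
  open GridCount m n
  open GridDistance m n using (steiner-distance)

-- The formula holds for all m and n.
theorem6p2 :
    ((m n : ℕ) → m ≥ 3 → n ≥ 3 →
      (d : V (P m □ P n) → V (P m □ P n) → V (P m □ P n) → ℕ) →
      (∀ x y z → IsSteinerDistance (P m □ P n) (x ∷ y ∷ z ∷ []) (d x y z)) →
      + 180 * + sww3Twice (gridVertices m n) d ≡
        + 9 * (+ m) ^ 5 * (+ n) ^ 3 + + 15 * (+ m) ^ 4 * (+ n) ^ 4 + + 9 * (+ m) ^ 3 * (+ n) ^ 5
        + + 15 * (+ m) ^ 4 * (+ n) ^ 3 + + 15 * (+ m) ^ 3 * (+ n) ^ 4 - + 30 * (+ m) ^ 4 * (+ n) ^ 2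
        - + 50 * (+ m) ^ 3 * (+ n) ^ 3 - + 30 * (+ m) ^ 2 * (+ n) ^ 4 + + 26 * (+ m) ^ 3 * (+ n)
        - + 45 * (+ m) ^ 3 * (+ n) ^ 2 - + 45 * (+ m) ^ 2 * (+ n) ^ 3 + + 45 * (+ m) ^ 2 * (+ n) ^ 2
        + + 26 * (+ m) * (+ n) ^ 3 + + 30 * (+ m) ^ 2 * (+ n) + + 30 * (+ m) * (+ n) ^ 2 - + 20 * (+ m) * (+ n))
    ×
    ((n : ℕ) → n ≥ 3 →
      (d : V (P 2 □ P n) → V (P 2 □ P n) → V (P 2 □ P n) → ℕ) →
      (∀ x y z → IsSteinerDistance (P 2 □ P n) (x ∷ y ∷ z ∷ []) (d x y z)) →
      + 15 * + sww3Twice (gridVertices 2 n) d ≡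
        + 2 * (+ 3 * (+ n) ^ 5 + + 10 * (+ n) ^ 4 - + 25 * (+ n) ^ 2 + + 12 * (+ n)))
theorem6p2 =
  (λ m n _ _ → sww3Twice-grid m n) ,
  (λ n _ d d-steiner → ladder-polynomial (+ sww3Twice (gridVertices 2 n) d) (+ n) (sww3Twice-grid 2 n d d-steiner))
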